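{- Let $X$ be a graph of valency $4$ admitting a half-arc-transitive subgroup $G$ of $\mathrm{Aut}\,X$ relative to which it is tightly attached of even radius at least $4$ (that is, $X$ is $G$-tightly attached and its $G$-radius is even and at least $4$). Then $X$ is isomorphic to $\mathcal{X}_e(m,n;r,t)$ for some even $m\ge 4$, some even $n\geq 4$, and some $r\in\mathbb{Z}_n^*$ and $t\in\mathbb{Z}_n$ satisfying $r^m=1$, $t(r-1)=0$ and $1+r+\cdots+r^{m-1}+2t=0$.
   Context: Graphs are finite, simple, connected and undirected. A subgroup $G\le\mathrm{Aut}\,X$ is half-arc-transitive on $X$ if it acts transitively on vertices and on edges of $X$ but not on arcs (ordered pairs of adjacent vertices). Let $G\le \mathrm{Aut}\,X$ be half-arc-transitive on a graph $X$ of valency $4$. Orient one edge and apply $G$ to obtain an orientation $D(X)$ of all edges. A $G$-alternating cycle is a cycle of even length in $X$ whose vertices are alternately the heads and the tails (in $D(X)$) of their two incident edges in the cycle. All $G$-alternating cycles have the same length $2r_G(X)$, $r_G(X)\ge 2$; $r_G(X)$ is the $G$-radius of $X$. Two $G$-alternating cycles are adjacent if they share a vertex; any two adjacent ones have the same number $a_G(X)$ of common vertices, called the $G$-attachment number. $X$ is $G$-tightly attached if $a_G(X)=r_G(X)$. For even integers $m,n\ge 4$ and $r\in\mathbb{Z}_n^*$, $t\in\mathbb{Z}_n$ satisfying $r^m=1$, $t(r-1)=0$ and $1+r+\cdots+r^{m-1}+2t=0$ in $\mathbb{Z}_n$, the graph $\mathcal{X}_e(m,n;r,t)$ has vertex set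 $\{u_i^j : i\in\mathbb{Z}_m, j\in\mathbb{Z}_n\}$ and edges given by: $u_i^j\sim u_{i+1}^j,\ u_{i+1}^{j+r^i}$ for $i\in\mathbb{Z}_m\setminus\{m-1\}$, $j\in\mathbb{Z}_n$; and $u_{m-1}^j\sim u_0^{j+t},\ u_0^{j+r^{m-1}+t}$ for $j\in\mathbb{Z}_n$. -}

module Defs where

open import Level using (Level; 0ℓ)
open import Algebra.Bundles.Raw using (RawRing)
import Algebra.Definitions.RawSemiring as RawSemiringDefs
open import Data.Fin.Base using (Fin; toℕ)
open import Data.Fin.Properties using (*↔×)
open import Data.Nat.Base using (ℕ; suc; _≤_; NonZero; >-nonZero; z≤n; s≤s)
  renaming (_+_ to _+ℕ_; _*_ to _*ℕ_; _∸_ to _∸ℕ_)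
open import Data.Nat.Divisibility using (_∣_)
open import Data.Nat.DivMod using (_mod_)
open import Data.Nat.Properties using (≤-trans; 1+n≢n)
open import Data.Product using (_×_; _,_; ∃; ∃-syntax; Σ-syntax)
open import Data.Sum.Base using (_⊎_; inj₁; inj₂)
open import Function.Bundles using (_↔_; _⇔_; Inverse; Equivalence; mk⇔)
open import Function.Definitions using (Injective)
open import Function.Construct.Identity using (↔-id)
open import Function.Construct.Composition using (_↔-∘_)
open import Function.Construct.Symmetry using (↔-sym)
open import Relation.Binary.Core using (Rel)
open import Relation.Binary.Definitions using (Symmetric)
open import Relation.Binary.Construct.Closure.ReflexiveTransitive using (Star)
open import Relation.Binary.Construct.Closure.Symmetric using (SymClosure; fwd; bwd; symmetric)
open import Relation.Binary.PropositionalEquality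
  using (_≡_; refl; sym; trans; subst₂)
open import Relation.Nullary.Negation using (¬_)
open import Relation.Unary using (Pred)

-- The integers modulo n, on the representatives 0, …, n - 1.
ℤ/ : (n : ℕ) .{{_ : NonZero n}} → RawRing 0ℓ 0ℓ
ℤ/ n = record
  { Carrier = Fin n
  ; _≈_     = _≡_
  ; _+_     = λ i j → (toℕ i +ℕ toℕ j) mod n
  ; _*_     = λ i j → (toℕ i *ℕ toℕ j) mod n
  ; -_      = λ i → (n ∸ℕ toℕ i) mod n
  ; 0#      = 0 mod n
  ; 1#      = 1 mod n
  }

_HasCardinality_ : ∀ {a p : Level} {A : Set a} → Pred A p → ℕ → Set _
_HasCardinality_ {A = A} P k =
  Σ[ f ∈ (Fin k → A) ] Injective _≡_ _≡_ f × (∀ x → P x ⇔ (∃[ i ] f i ≡ x))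

-- Finite simple undirected graphs; connectedness is the separate
-- predicate `Connected`.
record Graph : Set₁ where
  field
    Vertex  : Set
    order   : ℕ
    finite  : Fin order ↔ Vertex
    Adj     : Rel Vertex 0ℓ
    adj-sym : Symmetric Adj
    no-loop : ∀ {v} → ¬ Adj v v

open Graph using (Vertex; Adj)

Connected : Graph → Set
Connected X = ∀ u v → Star (Adj X) u v

HasValency : Graph → ℕ → Set
HasValency X k = ∀ v → Adj X v HasCardinality k

infix 4 _≅_

record _≅_ (X Y : Graph) : Set where
  field
    bij     : Vertex X ↔ Vertex Y
  open Inverse bij public using (to; from)
  field
    adj-iff : ∀ u v → Adj X u v ⇔ Adj Y (to u) (to v)

Aut : Graph → Set
Aut X = X ≅ X

module _ {X : Graph} where

  infixr 9 _⟨$⟩_ _∘ᴬ_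
  infix  4 _≈ᴬ_

  _⟨$⟩_ : Aut X → Vertex X → Vertex X
  g ⟨$⟩ v = _≅_.to g v

  _≈ᴬ_ : Rel (Aut X) 0ℓ
  g ≈ᴬ h = ∀ v → g ⟨$⟩ v ≡ h ⟨$⟩ v

  idᴬ : Aut X
  idᴬ = record
    { bij     = ↔-id _
    ; adj-iff = λ _ _ → mk⇔ (λ e → e) (λ e → e)
    }

  _∘ᴬ_ : Aut X → Aut X → Aut X
  g ∘ᴬ h = record
    { bij     = _≅_.bij g ↔-∘ _≅_.bij h
    ; adj-iff = λ u v → mk⇔
        (λ e → Equivalence.to (_≅_.adj-iff g _ _) (Equivalence.to (_≅_.adj-iff h u v) e))
        (λ e → Equivalence.from (_≅_.adj-iff h u v) (Equivalence.from (_≅_.adj-iff g _ _) e))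
    }

  _⁻¹ᴬ : Aut X → Aut X
  g ⁻¹ᴬ = record
    { bij     = ↔-sym (_≅_.bij g)
    ; adj-iff = λ u v → mk⇔
        (λ e → Equivalence.from (_≅_.adj-iff g _ _)
                 (subst₂ (Adj X) (sym (to∘from u)) (sym (to∘from v)) e))
        (λ e → subst₂ (Adj X) (to∘from u) (to∘from v)
                 (Equivalence.to (_≅_.adj-iff g _ _) e))
    }
    where
    to∘from : ∀ v → _≅_.to g (_≅_.from g v) ≡ v
    to∘from = Inverse.strictlyInverseˡ (_≅_.bij g)

-- `resp` makes membership depend only on the underlying permutation.
record Subgroup (X : Graph) : Set₁ where
  infix 4 _∈G
  field
    _∈G       : Pred (Aut X) 0ℓ
    resp      : ∀ {g h} → g ≈ᴬ h → g ∈G → h ∈G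
    id-closed : idᴬ ∈G
    ∘-closed  : ∀ {g h} → g ∈G → h ∈G → (g ∘ᴬ h) ∈G
    ⁻¹-closed : ∀ {g} → g ∈G → (g ⁻¹ᴬ) ∈G

record Arc (X : Graph) : Set where
  field
    tail : Vertex X
    head : Vertex X
    adj  : Adj X tail head

module _ {X : Graph} (G : Subgroup X) where
  open Subgroup G

  VertexTransitive : Set
  VertexTransitive = ∀ u v → ∃[ g ] g ∈G × g ⟨$⟩ u ≡ v

  EdgeTransitive : Set
  EdgeTransitive = ∀ {u v u′ v′} → Adj X u v → Adj X u′ v′ →
    ∃[ g ] g ∈G × ((g ⟨$⟩ u ≡ u′ × g ⟨$⟩ v ≡ v′) ⊎ (g ⟨$⟩ u ≡ v′ × g ⟨$⟩ v ≡ u′))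

  ArcTransitive : Set
  ArcTransitive = ∀ {u v u′ v′} → Adj X u v → Adj X u′ v′ →
    ∃[ g ] g ∈G × g ⟨$⟩ u ≡ u′ × g ⟨$⟩ v ≡ v′

  HalfArcTransitive : Set
  HalfArcTransitive = VertexTransitive × EdgeTransitive × ¬ ArcTransitive

-- Vertices are indexed by the integers modulo `len`.
record Cycle (X : Graph) : Set where
  field
    len   : ℕ
    3≤len : 3 ≤ len

  len≢0 : NonZero len
  len≢0 = >-nonZero (≤-trans (s≤s z≤n) 3≤len)

  open RawRing (ℤ/ len {{len≢0}}) using (_+_; -_; 1#)

  next : Fin len → Fin len
  next = λ i → i + 1#

  prev : Fin len → Fin len
  prev = λ i → i + (- 1#)

  field
    vertex    : Fin len → Vertex X
    injective : Injective _≡_ _≡_ vertex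
    adjacent  : ∀ i → Adj X (vertex i) (vertex (next i))

module _ {X : Graph} where

  _∈ⱽ_ : Vertex X → Cycle X → Set
  v ∈ⱽ C = ∃[ i ] Cycle.vertex C i ≡ v

  EdgeOf : Cycle X → Rel (Vertex X) 0ℓ
  EdgeOf C u v = ∃[ i ] ((vertex i ≡ u × vertex (next i) ≡ v)
                       ⊎ (vertex i ≡ v × vertex (next i) ≡ u))
    where open Cycle C

  -- Equality as subgraphs, disregarding starting point and direction.
  -- Comparing vertex sets would not do: distinct alternating cycles may
  -- have the same vertices.
  _≈ᶜ_ : Rel (Cycle X) 0ℓ
  C ≈ᶜ C′ = ∀ u v → EdgeOf C u v ⇔ EdgeOf C′ u v

  Common : Cycle X → Cycle X → Pred (Vertex X) 0ℓ
  Common C C′ v = v ∈ⱽ C × v ∈ⱽ C′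

  AdjacentCycles : Rel (Cycle X) 0ℓ
  AdjacentCycles C C′ = ¬ (C ≈ᶜ C′) × ∃ (Common C C′)

-- D(X) is the orbit of the chosen arc `o` under G.
module _ {X : Graph} (G : Subgroup X) (o : Arc X) where
  open Subgroup G
  open Arc o

  Oriented : Rel (Vertex X) 0ℓ
  Oriented u v = ∃[ g ] g ∈G × g ⟨$⟩ tail ≡ u × g ⟨$⟩ head ≡ v

  module _ (C : Cycle X) where
    open Cycle C

    IsTail IsHead : Fin len → Set
    IsTail i = Oriented (vertex i) (vertex (next i)) × Oriented (vertex i) (vertex (prev i))
    IsHead i = Oriented (vertex (next i)) (vertex i) × Oriented (vertex (prev i)) (vertex i)

    Alternating : Set
    Alternating = 2 ∣ len ×
      (∀ i → (IsTail i × IsHead (next i)) ⊎ (IsHead i × IsTail (next i)))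

  -- `IsRadius r` says that r is the radius: alternating cycles exist and
  -- 2r is their common length.  Similarly for the attachment number.
  IsRadius : ℕ → Set
  IsRadius r = ∃ Alternating × (∀ C → Alternating C → Cycle.len C ≡ 2 *ℕ r)

  IsAttachmentNumber : ℕ → Set
  IsAttachmentNumber a =
      (∃[ C ] ∃[ C′ ] Alternating C × Alternating C′ × AdjacentCycles C C′)
    × (∀ C C′ → Alternating C → Alternating C′ → AdjacentCycles C C′ →
         Common C C′ HasCardinality a)

  TightlyAttached : Set
  TightlyAttached = ∃[ r ] ∃[ a ] IsRadius r × IsAttachmentNumber a × a ≡ r

record Parameters : Set where
  field
    m n    : ℕ
    m-even : 2 ∣ m
    n-even : 2 ∣ n
    4≤m    : 4 ≤ m
    4≤n    : 4 ≤ n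

  n≢0 : NonZero n
  n≢0 = >-nonZero (≤-trans (s≤s z≤n) 4≤n)

  open RawRing (ℤ/ n {{n≢0}}) public using (_+_; _*_; -_; 0#; 1#; rawSemiring)
  open RawSemiringDefs rawSemiring public using (_^_; sum)

  field
    r t       : Fin n
    r-unit    : ∃[ s ] r * s ≡ 1#
    r^m≡1     : r ^ m ≡ 1#
    t[r-1]≡0  : t * (r + (- 1#)) ≡ 0#
    sum+2t≡0  : sum {m} (λ i → r ^ toℕ i) + (t + t) ≡ 0#

module _ (p : Parameters) where
  open Parameters p

  -- The pair (i , j) is the vertex u_i^j.
  data Step : Rel (Fin m × Fin n) 0ℓ where
    inner : ∀ {i i′ j j′} → toℕ i′ ≡ suc (toℕ i) →
            j′ ≡ j ⊎ j′ ≡ j + r ^ toℕ i →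
            Step (i , j) (i′ , j′)
    wrap  : ∀ {i i′ j j′} → toℕ i ≡ m ∸ℕ 1 → toℕ i′ ≡ 0 →
            j′ ≡ j + t ⊎ j′ ≡ (j + r ^ (m ∸ℕ 1)) + t →
            Step (i , j) (i′ , j′)

  private
    irrefl : ∀ {v} → ¬ Step v v
    irrefl (inner q _) = 1+n≢n (sym q)
    irrefl (wrap q q′ _) = absurd 4≤m (trans (sym q) q′)
      where
      absurd : ∀ {k} → 4 ≤ k → ¬ (k ∸ℕ 1 ≡ 0)
      absurd (s≤s (s≤s _)) ()

  𝒳ₑ : Graph
  𝒳ₑ = record
    { Vertex  = Fin m × Fin n
    ; order   = m *ℕ n
    ; finite  = *↔×
    ; Adj     = SymClosure Step
    ; adj-sym = symmetric Step
    ; no-loop = λ { (fwd s) → irrefl s ; (bwd s) → irrefl s }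
    }

{-# OPTIONS --safe #-}
module Submission where

-- Fix an alternating cycle C with tails A j = g^j v₀ and heads B j = g^j w₀, where g ∈ G rotates C by
-- two steps, and h ∈ G with h v₀ = w₀.  Since C and hC share exactly half of their vertices, the tails
-- of hC are the heads of C.  Hence an element of G fixing an arc v₀ → w₀ fixes the next alternating
-- cycle too, and so everything: G is regular on arcs, and identities in G can be tested on one arc.
-- Comparing the two rotations of the vertices common to C and hC gives h g = g^r h, and every vertex is
-- u_i^j = g^j h^i v₀.  If m is the first return time, h^m v₀ = g^t v₀, then either r t = t and r^m = 1
-- or r t = t + 1 and r^m = -1; the latter is impossible modulo 2 when n is even.  The reflection τ of C
-- at v₀ satisfies τ h = g h τ, so τ u_i^0 = u_i^s with s = 1 + r + ⋯ + r^(i-1), and i = m gives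
-- s + 2t = 0.  As r is odd, this forces m to be even.

open import Defs
open import Algebra.Bundles.Raw using (RawRing)
import Algebra.Definitions.RawSemiring as RawSemiringDefs
open import Data.Fin.Base as Fin using (Fin; zero; suc; toℕ; fromℕ<)
open import Data.Fin.Properties as Fin using (pigeonhole; toℕ-fromℕ<; toℕ<n; toℕ-injective; any?)
open import Data.Nat.Base
open import Data.Nat.DivMod
open import Data.Nat.Divisibility
open import Data.Nat.Properties hiding (_≟_)
import Data.Product as Product
open import Data.Product using (_×_; _,_; ∃-syntax; Σ; proj₁; proj₂)
import Data.Sum.Base as Sum
open import Data.Sum.Base using (_⊎_; inj₁; inj₂; [_,_]′)
open import Data.Vec.Base using (Vec; []; _∷_; lookup)
import Data.Vec.Relation.Unary.All as All
open import Data.Vec.Relation.Unary.All using ([]; _∷_)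
open import Data.Vec.Relation.Unary.All.Properties using (lookup⁺)
open import Data.Vec.Relation.Unary.AllPairs using ([]; _∷_)
open import Data.Vec.Relation.Unary.Unique.Propositional using (Unique)
open import Data.Vec.Relation.Unary.Unique.Propositional.Properties using (lookup-injective)
open import Function.Base using (_∘_; _$_)
open import Function.Bundles using (_⇔_; module Equivalence; module Inverse; mk⇔; mk↔ₛ′)
open import Function.Construct.Composition using (_⇔-∘_)
open import Function.Definitions using (Injective)
open import Function.Properties.Inverse using (↔⇒↣; ↔-sym)
open import Level using (0ℓ)
open import Relation.Binary.Construct.Closure.ReflexiveTransitive using (Star; ε; _◅_; _◅◅_)
open import Relation.Binary.Construct.Closure.Symmetric using (fwd; bwd)
open import Relation.Binary.Core using (Rel)
open import Relation.Binary.Definitions using (DecidableEquality)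
open import Relation.Binary.PropositionalEquality
open import Relation.Nullary using (¬_; yes; no; contradiction)
open import Relation.Nullary.Decidable using (map′; via-injection)
open import Relation.Unary using (Pred; Decidable)

open Graph using (Vertex; Adj; finite; adj-sym)

infix 4 _≋_[mod_]
_≋_[mod_] : ℕ → ℕ → (n : ℕ) .{{_ : NonZero n}} → Set
a ≋ b [mod n ] = a % n ≡ b % n

module _ (n : ℕ) .{{_ : NonZero n}} where

  ≋-+ : ∀ {a a′ b b′} → a ≋ a′ [mod n ] → b ≋ b′ [mod n ] → a + b ≋ a′ + b′ [mod n ]
  ≋-+ {a} {a′} {b} {b′} p q = trans (%-distribˡ-+ a b n)
    (trans (cong₂ (λ x y → (x + y) % n) p q) (sym (%-distribˡ-+ a′ b′ n)))

  ≋-* : ∀ {a a′ b b′} → a ≋ a′ [mod n ] → b ≋ b′ [mod n ] → a * b ≋ a′ * b′ [mod n ]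
  ≋-* {a} {a′} {b} {b′} p q = trans (%-distribˡ-* a b n)
    (trans (cong₂ (λ x y → (x * y) % n) p q) (sym (%-distribˡ-* a′ b′ n)))

  ≋⇒∣∸ : ∀ {a b} → a ≋ b [mod n ] → n ∣ b ∸ a
  ≋⇒∣∸ {a} {b} p = divides (b / n ∸ a / n) $ begin
    b ∸ a                                        ≡⟨ cong₂ _∸_ (m≡m%n+[m/n]*n b n) (m≡m%n+[m/n]*n a n) ⟩
    (b % n + b / n * n) ∸ (a % n + a / n * n)    ≡⟨ cong (λ x → (b % n + b / n * n) ∸ (x + a / n * n)) p ⟩
    (b % n + b / n * n) ∸ (b % n + a / n * n)    ≡⟨ [m+n]∸[m+o]≡n∸o (b % n) _ _ ⟩
    b / n * n ∸ a / n * n                        ≡⟨ *-distribʳ-∸ n (b / n) (a / n) ⟨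
    (b / n ∸ a / n) * n                          ∎
    where open ≡-Reasoning

  ∣∸⇒≋ : ∀ a b → n ∣ a ∸ b → n ∣ b ∸ a → a ≋ b [mod n ]
  ∣∸⇒≋ a b p q with ≤-total a b
  ... | inj₁ a≤b = sym (trans (cong (_% n) (sym (m+[n∸m]≡n a≤b))) (%-remove-+ʳ a q))
  ... | inj₂ b≤a = trans (cong (_% n) (sym (m+[n∸m]≡n b≤a))) (%-remove-+ʳ b p)

  ≋-+-cancelˡ : ∀ x {a b} → x + a ≋ x + b [mod n ] → a ≋ b [mod n ]
  ≋-+-cancelˡ x {a} {b} p = ∣∸⇒≋ a b
    (subst (n ∣_) ([m+n]∸[m+o]≡n∸o x a b) (≋⇒∣∸ (sym p)))
    (subst (n ∣_) ([m+n]∸[m+o]≡n∸o x b a) (≋⇒∣∸ p))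

  n*a≋0 : ∀ a → n * a ≋ 0 [mod n ]
  n*a≋0 a = trans (cong (_% n) (*-comm n a)) (trans (m*n%n≡0 a n) (sym (0%n≡0 n)))
    where
    0%n≡0 : ∀ n .{{_ : NonZero n}} → 0 % n ≡ 0
    0%n≡0 (suc _) = refl

  toℕ-mod : ∀ a → toℕ (a mod n) ≋ a [mod n ]
  toℕ-mod a = trans (cong (_% n) (toℕ-fromℕ< (m%n<n a n))) (m%n%n≡m%n a n)

  ≋⇒≡ : {i j : Fin n} → toℕ i ≋ toℕ j [mod n ] → i ≡ j
  ≋⇒≡ {i} {j} p = toℕ-injective
    (trans (sym (m<n⇒m%n≡m (toℕ<n i))) (trans p (m<n⇒m%n≡m (toℕ<n j))))

2*-≋-cancel : ∀ {L n} .{{_ : NonZero L}} .{{_ : NonZero n}} → L ≡ 2 * n →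
              ∀ {a b} → 2 * a ≋ 2 * b [mod L ] → a ≋ b [mod n ]
2*-≋-cancel {n = n} refl {a} {b} p = ∣∸⇒≋ n a b (half a b (≋⇒∣∸ (2 * n) (sym p))) (half b a (≋⇒∣∸ (2 * n) p))
  where
  half : ∀ a b → 2 * n ∣ 2 * a ∸ 2 * b → n ∣ a ∸ b
  half a b d = *-cancelˡ-∣ 2 (subst (2 * n ∣_) (sym (*-distribˡ-∸ 2 a b)) d)

2*-≋ : ∀ {L n} .{{_ : NonZero L}} .{{_ : NonZero n}} → L ≡ 2 * n →
       ∀ {a b} → a ≋ b [mod n ] → 2 * a ≋ 2 * b [mod L ]
2*-≋ {n = n} refl {a} {b} p = ∣∸⇒≋ (2 * n) (2 * a) (2 * b) (double a b (≋⇒∣∸ n (sym p))) (double b a (≋⇒∣∸ n p))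
  where
  double : ∀ a b → n ∣ a ∸ b → 2 * n ∣ 2 * a ∸ 2 * b
  double a b d = subst (2 * n ∣_) (*-distribˡ-∸ 2 a b) (*-monoʳ-∣ 2 d)

cardinality-≤ : ∀ {A : Set} {P : Pred A 0ℓ} {k l} → P HasCardinality k →
                (f : Fin l → A) → (∀ i → P (f i)) → Injective _≡_ _≡_ f → l ≤ k
cardinality-≤ {k = k} {l} (e , _ , P⇔) f Pf f-inj = Fin.injective⇒≤ {f = code} code-inj
  where
  code : Fin l → Fin k
  code i = proj₁ (Equivalence.to (P⇔ (f i)) (Pf i))
  e-code : ∀ i → e (code i) ≡ f i
  e-code i = proj₂ (Equivalence.to (P⇔ (f i)) (Pf i))
  code-inj : Injective _≡_ _≡_ code
  code-inj {i} {j} p = f-inj (trans (sym (e-code i)) (trans (cong e p) (e-code j)))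

distinct-≤ : ∀ {A : Set} {P : Pred A 0ℓ} {k l} → P HasCardinality k →
             (xs : Vec A l) → Unique xs → All.All P xs → l ≤ k
distinct-≤ c xs u ps = cardinality-≤ c (lookup xs) (lookup⁺ ps) (lookup-injective u _ _)

injective⇒surjective : ∀ {n} {f : Fin n → Fin n} → Injective _≡_ _≡_ f → ∀ j → ∃[ i ] f i ≡ j
injective⇒surjective {n} {f} f-inj j = hit (pigeonhole (n<1+n n) f′)
  where
  f′ : Fin (suc n) → Fin n
  f′ zero    = j
  f′ (suc i) = f i
  hit : ∃[ a ] ∃[ b ] (a Fin.< b × f′ a ≡ f′ b) → ∃[ i ] f i ≡ j
  hit (zero  , suc b , _   , p) = b , sym p
  hit (suc a , suc b , a<b , p) = contradiction (cong (suc ∘ toℕ) (f-inj p)) (<⇒≢ a<b)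
  hit (zero  , zero  , ()  , _)
  hit (suc _ , zero  , ()  , _)

HasCardinality-cong : ∀ {A : Set} {P Q : Pred A 0ℓ} {k} →
                      (∀ x → Q x ⇔ P x) → P HasCardinality k → Q HasCardinality k
HasCardinality-cong Q⇔P (f , f-inj , P⇔) = f , f-inj , λ x → P⇔ x ⇔-∘ Q⇔P x

small-≋ : ∀ {n} .{{_ : NonZero n}} {a b} → a < n → b < n → a ≋ b [mod n ] → a ≡ b
small-≋ a<n b<n p = trans (sym (m<n⇒m%n≡m a<n)) (trans p (m<n⇒m%n≡m b<n))

least : ∀ {P : Pred ℕ 0ℓ} → Decidable P → ∀ N → P N → ∃[ m ] P m × (∀ {k} → k < m → ¬ P k)
least P? N PN with P? 0
... | yes P0 = 0 , P0 , λ ()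
least P? zero    PN | no ¬P0 = contradiction PN ¬P0
least {P} P? (suc N) PN | no ¬P0 = let m , Pm , below = least (P? ∘ suc) N PN in
  suc m , Pm , λ { {zero} _ → ¬P0 ; {suc k} (s≤s k<m) → below k<m }

module IntegersModulo (n : ℕ) .{{_ : NonZero n}} where
  open RawRing (ℤ/ n) using (1#; rawSemiring) renaming (_+_ to _⊕_; _*_ to _⊛_)
  open RawSemiringDefs rawSemiring using (sum) renaming (_^_ to _⊛^_)

  toℕ-⊕ : ∀ i j → toℕ (i ⊕ j) ≋ toℕ i + toℕ j [mod n ]
  toℕ-⊕ i j = toℕ-mod n _

  toℕ-⊛ : ∀ i j → toℕ (i ⊛ j) ≋ toℕ i * toℕ j [mod n ]
  toℕ-⊛ i j = toℕ-mod n _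

  toℕ-^ : ∀ {i r} → toℕ i ≋ r [mod n ] → ∀ k → toℕ (i ⊛^ k) ≋ r ^ k [mod n ]
  toℕ-^ p zero    = toℕ-mod n 1
  toℕ-^ {i} p (suc k) = trans (toℕ-⊛ i (i ⊛^ k)) (≋-* n p (toℕ-^ p k))

  sum-scale : ∀ c m (f f′ : Fin m → Fin n) → (∀ i → toℕ (f i) ≋ c * toℕ (f′ i) [mod n ]) →
              toℕ (sum f) ≋ c * toℕ (sum f′) [mod n ]
  sum-scale c zero    f f′ p = trans (toℕ-mod n 0)
    (trans (cong (_% n) (sym (*-zeroʳ c))) (≋-* n {c} refl (sym (toℕ-mod n 0))))
  sum-scale c (suc m) f f′ p = begin
    toℕ (f zero ⊕ sum (f ∘ suc)) % n                    ≡⟨ toℕ-⊕ (f zero) _ ⟩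
    (toℕ (f zero) + toℕ (sum (f ∘ suc))) % n            ≡⟨ ≋-+ n (p zero) (sum-scale c m (f ∘ suc) (f′ ∘ suc) (p ∘ suc)) ⟩
    (c * toℕ (f′ zero) + c * toℕ (sum (f′ ∘ suc))) % n  ≡⟨ cong (_% n) (*-distribˡ-+ c (toℕ (f′ zero)) _) ⟨
    (c * (toℕ (f′ zero) + toℕ (sum (f′ ∘ suc)))) % n    ≡⟨ ≋-* n {c} refl (toℕ-⊕ (f′ zero) _) ⟨
    (c * toℕ (sum f′)) % n                              ∎
    where open ≡-Reasoning

  sum-powers-suc : ∀ {i r} → toℕ i ≋ r [mod n ] → ∀ m →
    toℕ (sum {suc m} (λ l → i ⊛^ toℕ l)) ≋ suc (r * toℕ (sum {m} (λ l → i ⊛^ toℕ l))) [mod n ]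
  sum-powers-suc {i} {r} p m = trans (toℕ-⊕ 1# _) (≋-+ n {b′ = r * toℕ (sum {m} (λ l → i ⊛^ toℕ l))} (toℕ-mod n 1)
    (sum-scale r m (λ l → i ⊛^ suc (toℕ l)) (λ l → i ⊛^ toℕ l)
      (λ l → trans (toℕ-⊛ i (i ⊛^ toℕ l)) (≋-* n {b = toℕ (i ⊛^ toℕ l)} p refl))))

even-or-odd : ∀ a → a ≋ 0 [mod 2 ] ⊎ a ≋ 1 [mod 2 ]
even-or-odd zero          = inj₁ refl
even-or-odd (suc zero)    = inj₂ refl
even-or-odd (suc (suc a)) = case′ (even-or-odd a)
  where
  case′ : a ≋ 0 [mod 2 ] ⊎ a ≋ 1 [mod 2 ] → 2 + a ≋ 0 [mod 2 ] ⊎ 2 + a ≋ 1 [mod 2 ]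
  case′ (inj₁ p) = inj₁ (≋-+ 2 {2} {0} {a} {0} refl p)
  case′ (inj₂ p) = inj₂ (≋-+ 2 {2} {0} {a} {1} refl p)

≋⇒≋2 : ∀ {n} .{{_ : NonZero n}} → 2 ∣ n → ∀ {a b} → a ≋ b [mod n ] → a ≋ b [mod 2 ]
≋⇒≋2 {n} 2∣n {a} {b} p = trans (sym (m∣n⇒o%n%m≡o%m 2 n a 2∣n))
  (trans (cong (_% 2) p) (m∣n⇒o%n%m≡o%m 2 n b 2∣n))

odd-base : ∀ r m → r ^ suc m ≋ 1 [mod 2 ] → r ≋ 1 [mod 2 ]
odd-base r m p with even-or-odd r
... | inj₂ q = q
... | inj₁ q with () ← trans (sym p) (≋-* 2 {r} {0} {r ^ m} {r ^ m} q refl)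

suc≋̸2 : ∀ t → ¬ t ≋ suc t [mod 2 ]
suc≋̸2 t p with () ← ≋-+-cancelˡ 2 t {0} {1}
  (trans (cong (_% 2) (+-identityʳ t)) (trans p (cong (_% 2) (+-comm 1 t))))

module Action {X : Graph} (G : Subgroup X) where
  open Subgroup G

  V : Set
  V = Vertex X

  K : Set
  K = Σ (Aut X) _∈G

  infixr 9 _·_
  infixl 10 _∙_
  infix 11 _⁻¹
  infix 12 _↑_

  _·_ : K → V → V
  k · x = proj₁ k ⟨$⟩ x

  e : K
  e = idᴬ , id-closed

  _∙_ : K → K → K
  k ∙ l = proj₁ k ∘ᴬ proj₁ l , ∘-closed (proj₂ k) (proj₂ l)

  _⁻¹ : K → K
  k ⁻¹ = (proj₁ k) ⁻¹ᴬ , ⁻¹-closed (proj₂ k)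

  _↑_ : K → ℕ → K
  k ↑ zero  = e
  k ↑ suc j = k ∙ k ↑ j

  ⁻¹-cancelˡ : ∀ k {x} → k ⁻¹ · k · x ≡ x
  ⁻¹-cancelˡ k = Inverse.strictlyInverseʳ (_≅_.bij (proj₁ k)) _

  ⁻¹-cancelʳ : ∀ k {x} → k · k ⁻¹ · x ≡ x
  ⁻¹-cancelʳ k = Inverse.strictlyInverseˡ (_≅_.bij (proj₁ k)) _

  ·-injective : ∀ k {x y} → k · x ≡ k · y → x ≡ y
  ·-injective k p = trans (sym (⁻¹-cancelˡ k)) (trans (cong (k ⁻¹ ·_) p) (⁻¹-cancelˡ k))

  ⁻¹-swap : ∀ k {x y} → k · x ≡ y → x ≡ k ⁻¹ · y
  ⁻¹-swap k p = trans (sym (⁻¹-cancelˡ k)) (cong (k ⁻¹ ·_) p)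

  ⁻¹-swapʳ : ∀ k {x y} → x ≡ k · y → k ⁻¹ · x ≡ y
  ⁻¹-swapʳ k p = sym (⁻¹-swap k (sym p))

  ↑-comm : ∀ k j {x} → k · k ↑ j · x ≡ k ↑ j · k · x
  ↑-comm k zero    = refl
  ↑-comm k (suc j) = cong (k ·_) (↑-comm k j)

  ↑-+ : ∀ k i j {x} → k ↑ (i + j) · x ≡ k ↑ i · k ↑ j · x
  ↑-+ k zero    j = refl
  ↑-+ k (suc i) j = cong (k ·_) (↑-+ k i j)

  ↑-swap : ∀ k i j {x} → k ↑ i · k ↑ j · x ≡ k ↑ j · k ↑ i · x
  ↑-swap k i j {x} = trans (sym (↑-+ k i j)) (trans (cong (λ a → k ↑ a · x) (+-comm i j)) (↑-+ k j i))

  ↑-period : ∀ k n {x} → k ↑ n · x ≡ x → ∀ q → k ↑ (q * n) · x ≡ x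
  ↑-period k n p zero    = refl
  ↑-period k n p (suc q) = trans (↑-+ k n (q * n)) (trans (cong (k ↑ n ·_) (↑-period k n p q)) p)

  ↑-≋ : ∀ k n .{{_ : NonZero n}} {x} → k ↑ n · x ≡ x → ∀ {a b} → a ≋ b [mod n ] → k ↑ a · x ≡ k ↑ b · x
  ↑-≋ k n {x} p {a} {b} a≋b = trans (reduce a) (trans (cong (λ i → k ↑ i · x) a≋b) (sym (reduce b)))
    where
    reduce : ∀ a → k ↑ a · x ≡ k ↑ (a % n) · x
    reduce a = trans (cong (λ i → k ↑ i · x) (m≡m%n+[m/n]*n a n))
      (trans (↑-+ k (a % n) (a / n * n)) (cong (k ↑ (a % n) ·_) (↑-period k n p (a / n))))

  _≟_ : DecidableEquality V
  _≟_ = via-injection (↔⇒↣ (↔-sym (finite X))) Fin._≟_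

  returns : ∀ k x → ∃[ N ] k ↑ suc N · x ≡ x
  returns k x = go (pigeonhole (n<1+n _) (λ i → Inverse.from (finite X) (k ↑ toℕ i · x)))
    where
    go : ∃[ i ] ∃[ j ] (i Fin.< j × Inverse.from (finite X) (k ↑ toℕ i · x)
                                     ≡ Inverse.from (finite X) (k ↑ toℕ j · x)) →
         ∃[ N ] k ↑ suc N · x ≡ x
    go (i , j , i<j , p) = d , ·-injective (k ↑ toℕ i) (begin
      k ↑ toℕ i · k ↑ suc d · x   ≡⟨ ↑-+ k (toℕ i) (suc d) ⟨
      k ↑ (toℕ i + suc d) · x     ≡⟨ cong (λ a → k ↑ a · x) (trans (+-suc (toℕ i) d) (m+[n∸m]≡n i<j)) ⟩
      k ↑ toℕ j · x               ≡⟨ Inverse.strictlyInverseˡ (finite X) _ ⟨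
      Inverse.to (finite X) (Inverse.from (finite X) (k ↑ toℕ j · x)) ≡⟨ cong (Inverse.to (finite X)) (sym p) ⟩
      Inverse.to (finite X) (Inverse.from (finite X) (k ↑ toℕ i · x)) ≡⟨ Inverse.strictlyInverseˡ (finite X) _ ⟩
      k ↑ toℕ i · x               ∎)
      where
      open ≡-Reasoning
      d = toℕ j ∸ suc (toℕ i)

module Orientation {X : Graph} (conn : Connected X) (val : HasValency X 4)
                   (G : Subgroup X) (hat : HalfArcTransitive G) (o : Arc X) where
  open Subgroup G
  open Action G
  open Arc o

  infix 4 _⟶_
  _⟶_ : Rel V 0ℓ
  _⟶_ = Oriented G o

  ⟶-·  : ∀ k {x y} → x ⟶ y → k · x ⟶ k · y
  ⟶-· k (p , p∈ , t , h) = proj₁ k ∘ᴬ p , ∘-closed (proj₂ k) p∈ , cong (k ·_) t , cong (k ·_) h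

  ⟶⇒Adj : ∀ {x y} → x ⟶ y → Adj X x y
  ⟶⇒Adj (p , _ , t , h) = subst₂ (Adj X) t h (Equivalence.to (_≅_.adj-iff p _ _) adj)

  Adj⇒⟶ : ∀ {x y} → Adj X x y → x ⟶ y ⊎ y ⟶ x
  Adj⇒⟶ xy with proj₁ (proj₂ hat) adj xy
  ... | p , p∈ , inj₁ (t , h) = inj₁ (p , p∈ , t , h)
  ... | p , p∈ , inj₂ (t , h) = inj₂ (p , p∈ , t , h)

  transport : ∀ {x y x′ y′} → x ⟶ y → x′ ⟶ y′ → ∃[ k ] k · x ≡ x′ × k · y ≡ y′
  transport (p , p∈ , t , h) (q , q∈ , t′ , h′) =
    (q , q∈) ∙ (p , p∈) ⁻¹ ,
    trans (cong (q ⟨$⟩_) (⁻¹-swapʳ (p , p∈) (sym t))) t′ ,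
    trans (cong (q ⟨$⟩_) (⁻¹-swapʳ (p , p∈) (sym h))) h′

  ⟶-asym : ∀ {x y} → x ⟶ y → ¬ y ⟶ x
  ⟶-asym x⟶y y⟶x = proj₂ (proj₂ hat) λ uv u′v′ → pack (transport (both uv) (both u′v′))
    where
    reverse : ∀ {u v} → u ⟶ v → v ⟶ u
    reverse u⟶v = let k , p , q = transport x⟶y u⟶v in subst₂ _⟶_ q p (⟶-· k y⟶x)
    both : ∀ {u v} → Adj X u v → u ⟶ v
    both uv = [ (λ a → a) , reverse ]′ (Adj⇒⟶ uv)
    pack : ∀ {u v u′ v′} → ∃[ k ] k · u ≡ u′ × k · v ≡ v′ →
           ∃[ g ] g ∈G × g ⟨$⟩ u ≡ u′ × g ⟨$⟩ v ≡ v′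
    pack ((g , g∈) , p , q) = g , g∈ , p , q

  move : ∀ x y → ∃[ k ] k · x ≡ y
  move x y = let g , g∈ , p = proj₁ hat x y in (g , g∈) , p

  ⟶*-iterate : ∀ k {x} → x ⟶ k · x → ∀ N → Star _⟶_ x (k ↑ N · x)
  ⟶*-iterate k a zero    = ε
  ⟶*-iterate k a (suc N) = a ◅ subst (Star _⟶_ _) (sym (↑-comm k N)) (⟶*-iterate k (⟶-· k a) N)

  -- Some k ∈ G takes x to y; iterating k runs from y around to x again.
  ⟶*-back : ∀ {x y} → x ⟶ y → Star _⟶_ y x
  ⟶*-back {x} {y} a with move x y
  ... | k , refl = let N , p = returns k x in
    subst (Star _⟶_ y) (trans (sym (↑-comm k N)) p) (⟶*-iterate k (⟶-· k a) N)

  strongly-connected : ∀ x y → Star _⟶_ x y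
  strongly-connected x y = go (conn x y)
    where
    go : ∀ {x y} → Star (Adj X) x y → Star _⟶_ x y
    go ε        = ε
    go (a ◅ as) = [ (λ b → b ◅ ε) , ⟶*-back ]′ (Adj⇒⟶ a) ◅◅ go as

  third-neighbour : ∀ {P Q : Pred V 0ℓ} {v a b p q} →
    (∀ {z} → P z → Adj X v z) → (∀ {z} → Q z → Adj X v z) → (∀ {z} → P z → ¬ Q z) →
    P a → P b → a ≢ b → Q p → Q q → p ≢ q → ∀ {c} → P c → c ≡ a ⊎ c ≡ b
  third-neighbour {P} {Q} {v} {a} {b} {p} {q} P⇒ Q⇒ dis Pa Pb a≢b Qp Qq p≢q {c} Pc
    with c ≟ a | c ≟ b
  ... | yes c≡a | _       = inj₁ c≡a
  ... | no _    | yes c≡b = inj₂ c≡b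
  ... | no c≢a  | no c≢b  = contradiction
    (distinct-≤ (val v) (c ∷ a ∷ b ∷ p ∷ q ∷ [])
      ( (c≢a ∷ c≢b ∷ ≢Q Pc Qp ∷ ≢Q Pc Qq ∷ []) ∷ (a≢b ∷ ≢Q Pa Qp ∷ ≢Q Pa Qq ∷ [])
      ∷ (≢Q Pb Qp ∷ ≢Q Pb Qq ∷ []) ∷ (p≢q ∷ []) ∷ [] ∷ [])
      (P⇒ Pc ∷ P⇒ Pa ∷ P⇒ Pb ∷ Q⇒ Qp ∷ Q⇒ Qq ∷ []))
    (<⇒≱ (n<1+n 4))
    where
    ≢Q : ∀ {x y} → P x → Q y → x ≢ y
    ≢Q Px Qy refl = dis Px Qy

  module Valency {s a b t p q : V} (s⟶a : s ⟶ a) (s⟶b : s ⟶ b) (a≢b : a ≢ b)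
                 (p⟶t : p ⟶ t) (q⟶t : q ⟶ t) (p≢q : p ≢ q) where

    two-out : ∀ v → ∃[ a ] ∃[ b ] v ⟶ a × v ⟶ b × a ≢ b
    two-out v with move s v
    ... | k , refl = k · a , k · b , ⟶-· k s⟶a , ⟶-· k s⟶b , a≢b ∘ ·-injective k

    two-in : ∀ v → ∃[ p ] ∃[ q ] p ⟶ v × q ⟶ v × p ≢ q
    two-in v with move t v
    ... | k , refl = k · p , k · q , ⟶-· k p⟶t , ⟶-· k q⟶t , p≢q ∘ ·-injective k

    outs : ∀ {v x y z} → v ⟶ x → v ⟶ y → x ≢ y → v ⟶ z → z ≡ x ⊎ z ≡ y
    outs {v} vx vy x≢y vz = let p , q , pv , qv , p≢q = two-in v in
      third-neighbour {P = v ⟶_} {Q = _⟶ v} ⟶⇒Adj (adj-sym X ∘ ⟶⇒Adj) ⟶-asym vx vy x≢y pv qv p≢q vz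

    ins : ∀ {v x y z} → x ⟶ v → y ⟶ v → x ≢ y → z ⟶ v → z ≡ x ⊎ z ≡ y
    ins {v} xv yv x≢y zv = let a , b , va , vb , a≢b = two-out v in
      third-neighbour {P = _⟶ v} {Q = v ⟶_} (adj-sym X ∘ ⟶⇒Adj) ⟶⇒Adj ⟶-asym xv yv x≢y va vb a≢b zv

    zigzag-shift : ∀ {a b : ℕ → V} → (∀ j → a j ⟶ b j) → (∀ j → a (suc j) ⟶ b j) →
      (∀ j → a j ≢ a (suc j)) → (∀ j → b j ≢ b (suc j)) →
      ∀ k → k · a 1 ≡ a 2 → k · b 0 ≡ b 1 → ∀ j → k · a (suc j) ≡ a (2 + j) × k · b j ≡ b (suc j)
    zigzag-shift ab a′b a≢ b≢ k ka kb zero = ka , kb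
    zigzag-shift {a} {b} ab a′b a≢ b≢ k ka kb (suc j) = ka′ , kb′
      where
      ih = zigzag-shift ab a′b a≢ b≢ k ka kb j
      kb′ : k · b (suc j) ≡ b (2 + j)
      kb′ with outs (a′b (suc j)) (ab (2 + j)) (b≢ (suc j))
                    (subst (_⟶ k · b (suc j)) (proj₁ ih) (⟶-· k (ab (suc j))))
      ... | inj₁ p = contradiction (·-injective k (trans (proj₂ ih) (sym p))) (b≢ j)
      ... | inj₂ p = p
      ka′ : k · a (2 + j) ≡ a (3 + j)
      ka′ with ins (ab (2 + j)) (a′b (2 + j)) (a≢ (2 + j))
                   (subst (k · a (2 + j) ⟶_) kb′ (⟶-· k (a′b (suc j))))
      ... | inj₁ p = contradiction (·-injective k (trans (proj₁ ih) (sym p))) (a≢ (suc j))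
      ... | inj₂ p = p

module TightlyAttachedGraph {X : Graph} (conn : Connected X) (val : HasValency X 4)
                            (G : Subgroup X) (hat : HalfArcTransitive G) (o : Arc X) where
  open Action G
  open Orientation conn val G hat o

  module AlternatingCycle
    (n : ℕ) .{{_ : NonZero n}} (4≤n : 4 ≤ n) {v₀ w₀ : V} (g : K)
    (v₀⟶w₀ : v₀ ⟶ w₀) (v₀⟶gw₀ : v₀ ⟶ g · w₀)
    (A-free : ∀ i j → g ↑ i · v₀ ≡ g ↑ j · v₀ → i ≋ j [mod n ])
    (B-free : ∀ i j → g ↑ i · w₀ ≡ g ↑ j · w₀ → i ≋ j [mod n ])
    (A-B-disjoint : ∀ i j → g ↑ i · v₀ ≢ g ↑ j · w₀)
    (A-period : g ↑ n · v₀ ≡ v₀)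
    where

    A B : ℕ → V
    A j = g ↑ j · v₀
    B j = g ↑ j · w₀

    A-inj : ∀ {i j} → A i ≡ A j → i ≋ j [mod n ]
    A-inj {i} {j} = A-free i j

    B-inj : ∀ {i j} → B i ≡ B j → i ≋ j [mod n ]
    B-inj {i} {j} = B-free i j

    A≢B : ∀ {i j} → A i ≢ B j
    A≢B {i} {j} = A-B-disjoint i j

    0≢1 : ¬ 0 ≋ 1 [mod n ]
    0≢1 p with () ← small-≋ (≤-trans (s≤s z≤n) 4≤n) (≤-trans (s≤s (s≤s z≤n)) 4≤n) p

    0≢2 : ¬ 0 ≋ 2 [mod n ]
    0≢2 p with () ← small-≋ (≤-trans (s≤s z≤n) 4≤n) (≤-trans (s≤s (s≤s (s≤s z≤n))) 4≤n) p

    v₀≢gv₀ : v₀ ≢ g · v₀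
    v₀≢gv₀ p = 0≢1 (A-inj {0} {1} p)

    w₀≢gw₀ : w₀ ≢ g · w₀
    w₀≢gw₀ p = 0≢1 (B-inj {0} {1} p)

    open Valency v₀⟶w₀ v₀⟶gw₀ w₀≢gw₀ v₀⟶gw₀ (⟶-· g v₀⟶w₀) v₀≢gv₀ public

    out₀ : ∀ {z} → v₀ ⟶ z → z ≡ w₀ ⊎ z ≡ g · w₀
    out₀ = outs v₀⟶w₀ v₀⟶gw₀ w₀≢gw₀

    in₁ : ∀ {z} → z ⟶ g · w₀ → z ≡ v₀ ⊎ z ≡ g · v₀
    in₁ = ins v₀⟶gw₀ (⟶-· g v₀⟶w₀) v₀≢gv₀

    out-image : ∀ k {y z} → y ≡ k · v₀ → y ⟶ z → z ≡ k · w₀ ⊎ z ≡ k · g · w₀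
    out-image k {z = z} refl a with out₀ (subst (_⟶ k ⁻¹ · z) (⁻¹-cancelˡ k) (⟶-· (k ⁻¹) a))
    ... | inj₁ p = inj₁ (trans (sym (⁻¹-cancelʳ k)) (cong (k ·_) p))
    ... | inj₂ p = inj₂ (trans (sym (⁻¹-cancelʳ k)) (cong (k ·_) p))

    in-image : ∀ k {y z} → y ≡ k · g · w₀ → z ⟶ y → z ≡ k · v₀ ⊎ z ≡ k · g · v₀
    in-image k {z = z} refl a with in₁ (subst (k ⁻¹ · z ⟶_) (⁻¹-cancelˡ k) (⟶-· (k ⁻¹) a))
    ... | inj₁ p = inj₁ (trans (sym (⁻¹-cancelʳ k)) (cong (k ·_) p))
    ... | inj₂ p = inj₂ (trans (sym (⁻¹-cancelʳ k)) (cong (k ·_) p))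

    A⟶B : ∀ j → A j ⟶ B j
    A⟶B j = ⟶-· (g ↑ j) v₀⟶w₀

    A⟶Bsuc : ∀ j → A j ⟶ B (suc j)
    A⟶Bsuc j = subst (A j ⟶_) (sym (↑-comm g j)) (⟶-· (g ↑ j) v₀⟶gw₀)

    out-A : ∀ j {z} → A j ⟶ z → z ≡ B j ⊎ z ≡ B (suc j)
    out-A j a with out-image (g ↑ j) refl a
    ... | inj₁ p = inj₁ p
    ... | inj₂ p = inj₂ (trans p (sym (↑-comm g j)))

    in-B : ∀ j {z} → z ⟶ B j → z ≡ A j ⊎ g · z ≡ A j
    in-B j a with in-image (g ↑ j) (↑-comm g j) (⟶-· g a)
    ... | inj₁ p = inj₂ p
    ... | inj₂ p = inj₁ (·-injective g (trans p (sym (↑-comm g j))))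

    gⁿw₀≡w₀ : g ↑ n · w₀ ≡ w₀
    gⁿw₀≡w₀ with out-image (g ↑ n) (sym A-period) v₀⟶w₀
    ... | inj₁ p = sym p
    ... | inj₂ p = contradiction
      (trans (B-inj {0} {suc n} (trans p (sym (↑-comm g n)))) ([m+n]%n≡m%n 1 n)) 0≢1

    A-≋ : ∀ {i j} → i ≋ j [mod n ] → A i ≡ A j
    A-≋ = ↑-≋ g n A-period

    B-≋ : ∀ {i j} → i ≋ j [mod n ] → B i ≡ B j
    B-≋ = ↑-≋ g n gⁿw₀≡w₀

    InA InB InC : Pred V 0ℓ
    InA z = ∃[ j ] z ≡ A j
    InB z = ∃[ j ] z ≡ B j
    InC z = InA z ⊎ InB z

    fixes-cycle : ∀ k → k · v₀ ≡ v₀ → k · w₀ ≡ w₀ → ∀ j → k · A j ≡ A j × k · B j ≡ B j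
    fixes-cycle k kv kw zero = kv , kw
    fixes-cycle k kv kw (suc j) = up (proj₁ ih) , up (proj₂ ih)
      where
      kgw : k · g · w₀ ≡ g · w₀
      kgw with out₀ (subst (_⟶ k · g · w₀) kv (⟶-· k v₀⟶gw₀))
      ... | inj₁ p = contradiction (·-injective k (trans kw (sym p))) w₀≢gw₀
      ... | inj₂ p = p
      kgv : k · g · v₀ ≡ g · v₀
      kgv with in₁ (subst (k · g · v₀ ⟶_) kgw (⟶-· k (⟶-· g v₀⟶w₀)))
      ... | inj₁ p = contradiction (·-injective k (trans kv (sym p))) v₀≢gv₀
      ... | inj₂ p = p
      ih = fixes-cycle (g ⁻¹ ∙ (k ∙ g)) (⁻¹-swapʳ g kgv) (⁻¹-swapʳ g kgw) j
      up : ∀ {x} → (g ⁻¹ ∙ (k ∙ g)) · x ≡ x → k · g · x ≡ g · x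
      up p = trans (sym (⁻¹-cancelʳ g)) (cong (g ·_) p)

    reflection-step : ∀ k → k · v₀ ≡ v₀ → k · w₀ ≡ g · w₀ → g · k · g · v₀ ≡ v₀ × k · g · w₀ ≡ w₀
    reflection-step k kv kw = gkgv , kgw
      where
      kgw : k · g · w₀ ≡ w₀
      kgw with out₀ (subst (_⟶ k · g · w₀) kv (⟶-· k v₀⟶gw₀))
      ... | inj₁ p = p
      ... | inj₂ p = contradiction (·-injective k (trans kw (sym p))) w₀≢gw₀
      gkgv : g · k · g · v₀ ≡ v₀
      gkgv with in₁ (subst (g · k · g · v₀ ⟶_) (cong (g ·_) kgw) (⟶-· g (⟶-· k (⟶-· g v₀⟶w₀))))
      ... | inj₁ p = p
      ... | inj₂ p = contradiction (·-injective k (trans kv (·-injective g (sym p)))) v₀≢gv₀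

    reflects-cycle : ∀ k → k · v₀ ≡ v₀ → k · w₀ ≡ g · w₀ →
                     ∀ j → g ↑ j · k · A j ≡ v₀ × g ↑ j · k · B j ≡ g · w₀
    reflects-cycle k kv kw zero = kv , kw
    reflects-cycle k kv kw (suc j) =
      let gkgv , kgw = reflection-step k kv kw
          p , q = reflects-cycle (g ∙ (k ∙ g)) gkgv (cong (g ·_) kgw) j
      in trans (↑-comm g j) p , trans (↑-comm g j) q

    inverse-exponent : ℕ → ℕ
    inverse-exponent i = pred n * i

    ↑-inverse : ∀ i → g ↑ i · g ↑ inverse-exponent i · v₀ ≡ v₀
    ↑-inverse i = trans (sym (↑-+ g i (pred n * i))) (A-≋ (trans
      (cong (λ N → (N * i) % n) (suc-pred n)) (n*a≋0 n i)))

    ↑-inverseʷ : ∀ i → g ↑ i · g ↑ inverse-exponent i · w₀ ≡ w₀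
    ↑-inverseʷ i = trans (sym (↑-+ g i (pred n * i))) (B-≋ (trans
      (cong (λ N → (N * i) % n) (suc-pred n)) (n*a≋0 n i)))

    InA-back : ∀ i {x} → InA (g ↑ i · x) → InA x
    InA-back i {x} (j , p) = inverse-exponent i + j , ·-injective (g ↑ i) (begin
      g ↑ i · x                               ≡⟨ p ⟩
      g ↑ j · v₀                              ≡⟨ cong (g ↑ j ·_) (↑-inverse i) ⟨
      g ↑ j · g ↑ i · g ↑ (pred n * i) · v₀   ≡⟨ ↑-swap g j i ⟩
      g ↑ i · g ↑ j · g ↑ (pred n * i) · v₀   ≡⟨ cong (g ↑ i ·_) (↑-swap g j (pred n * i)) ⟩
      g ↑ i · g ↑ (pred n * i) · g ↑ j · v₀   ≡⟨ cong (g ↑ i ·_) (↑-+ g (pred n * i) j) ⟨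
      g ↑ i · A (pred n * i + j)              ∎)
      where open ≡-Reasoning

    InB-back : ∀ i {x} → InB (g ↑ i · x) → InB x
    InB-back i {x} (j , p) = inverse-exponent i + j , ·-injective (g ↑ i) (begin
      g ↑ i · x                               ≡⟨ p ⟩
      g ↑ j · w₀                              ≡⟨ cong (g ↑ j ·_) (↑-inverseʷ i) ⟨
      g ↑ j · g ↑ i · g ↑ (pred n * i) · w₀   ≡⟨ ↑-swap g j i ⟩
      g ↑ i · g ↑ j · g ↑ (pred n * i) · w₀   ≡⟨ cong (g ↑ i ·_) (↑-swap g j (pred n * i)) ⟩
      g ↑ i · g ↑ (pred n * i) · g ↑ j · w₀   ≡⟨ cong (g ↑ i ·_) (↑-+ g (pred n * i) j) ⟨
      g ↑ i · B (pred n * i + j)              ∎)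
      where open ≡-Reasoning

    InA-forth : ∀ i {x} → InA x → InA (g ↑ i · x)
    InA-forth i (j , refl) = i + j , sym (↑-+ g i j)

    InB-forth : ∀ i {x} → InB x → InB (g ↑ i · x)
    InB-forth i (j , refl) = i + j , sym (↑-+ g i j)

    in-InB : ∀ {y z} → InB y → z ⟶ y → InA z
    in-InB (j , refl) a with in-B j a
    ... | inj₁ p = j , p
    ... | inj₂ p = InA-back 1 (j , p)

    stabiliser₀ : ∀ k → k · v₀ ≡ v₀ → ∀ l → InA (k · A l) × InB (k · B l)
    stabiliser₀ k kv l with out₀ (subst (_⟶ k · w₀) kv (⟶-· k v₀⟶w₀))
    ... | inj₁ kw = let p , q = fixes-cycle k kv kw l in (l , p) , (l , q)
    ... | inj₂ kw = let p , q = reflects-cycle k kv kw l in InA-back l (0 , p) , InB-back l (1 , q)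

    stabiliser : ∀ k → InA (k · v₀) → (∀ {x} → InA x → InA (k · x)) × (∀ {x} → InB x → InB (k · x))
    stabiliser k (i , kv) =
        (λ { (l , refl) → back InA InA-forth (proj₁ (s l)) })
      , (λ { (l , refl) → back InB InB-forth (proj₂ (s l)) })
      where
      s = stabiliser₀ ((g ↑ i) ⁻¹ ∙ k) (⁻¹-swapʳ (g ↑ i) kv)
      back : (P : Pred V 0ℓ) → (∀ i {x} → P x → P (g ↑ i · x)) →
             ∀ {x} → P (((g ↑ i) ⁻¹ ∙ k) · x) → P (k · x)
      back P forth {x} q = subst P (⁻¹-cancelʳ (g ↑ i)) (forth i q)

    stabiliser-A : ∀ k {x} → InA x → InA (k · x) →
                   (∀ {x} → InA x → InA (k · x)) × (∀ {x} → InB x → InB (k · x))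
    stabiliser-A k (j , refl) kx =
      let preA , preB = stabiliser (k ∙ g ↑ j) kx in
        (λ p → let q = InA-back j (subst InA (sym (⁻¹-cancelʳ (g ↑ j))) p)
               in subst (λ z → InA (k · z)) (⁻¹-cancelʳ (g ↑ j)) (preA q))
      , (λ p → let q = InB-back j (subst InB (sym (⁻¹-cancelʳ (g ↑ j))) p)
               in subst (λ z → InB (k · z)) (⁻¹-cancelʳ (g ↑ j)) (preB q))

    module Attached (h : K) (hv₀ : h · v₀ ≡ w₀)
      (attached : (λ z → InC z × ∃[ x ] InC x × h · x ≡ z) HasCardinality n) where

      hA∌A : ∀ {x} → InA x → ¬ InA (h · x)
      hA∌A x hx with proj₁ (stabiliser-A h x hx) (0 , refl)
      ... | j , p = A≢B {j} {0} (trans (sym p) hv₀)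

      -- An arc from B to A would force C ⊆ hC, so that C and hC share more than n vertices.
      B⟶A : ∀ {x y} → InB x → InA y → ¬ x ⟶ y
      B⟶A {x} {y} (i , refl) (i′ , refl) a =
        contradiction (cardinality-≤ attached many many-InC many-inj) (<⇒≱ (n<1+n n))
        where
        in-kB : ∀ k {z} → z ⟶ k · v₀ → ∃[ b ] InB b × z ≡ k · b
        in-kB k {z} zk with transport a zk
        ... | k₁ , p , q = k ⁻¹ · z ,
              subst InB (cong (k ⁻¹ ·_) p)
                (proj₂ (stabiliser-A (k ⁻¹ ∙ k₁) (i′ , refl) (0 , ⁻¹-swapʳ k q)) (i , refl)) ,
              sym (⁻¹-cancelʳ k)
        hB∋v₀ : ∃[ b ] InB b × v₀ ≡ h · b
        hB∋v₀ = in-kB h (subst (v₀ ⟶_) (sym hv₀) v₀⟶w₀)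
        ghB∋v₀ : ∃[ b ] InB b × v₀ ≡ g · h · b
        ghB∋v₀ = in-kB (g ∙ h) (subst (v₀ ⟶_) (cong (g ·_) (sym hv₀)) v₀⟶gw₀)
        k : K
        k = h ⁻¹ ∙ (g ∙ h)
        k-stab : (∀ {x} → InA x → InA (k · x)) × (∀ {x} → InB x → InB (k · x))
        k-stab with hB∋v₀ | ghB∋v₀
        ... | b , b∈ , p | b′ , (j , refl) , p′ =
          stabiliser-A k (j , refl) (in-InB (subst InB (⁻¹-swap h (trans (sym p) p′)) b∈) (⟶-· k (A⟶B j)))
        hP-closed : (P : Pred V 0ℓ) → (∀ {x} → P x → P (k · x)) →
                    ∀ j {z} → ∃[ x ] P x × z ≡ h · x → ∃[ x ] P x × g ↑ j · z ≡ h · x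
        hP-closed P cl zero    q = q
        hP-closed P cl (suc j) q with hP-closed P cl j q
        ... | x , Px , p = k · x , cl Px , trans (cong (g ·_) p) (sym (⁻¹-cancelʳ h))
        many : Fin (suc n) → V
        many zero    = v₀
        many (suc i) = B (toℕ i)
        many-InC : ∀ i → InC (many i) × ∃[ x ] InC x × h · x ≡ many i
        many-InC zero    = inj₁ (0 , refl) , (let b , b∈ , p = hB∋v₀ in b , inj₂ b∈ , sym p)
        many-InC (suc i) = inj₂ (toℕ i , refl) ,
          (let x , x∈ , p = hP-closed InA (proj₁ k-stab) (toℕ i) (v₀ , (0 , refl) , sym hv₀) in x , inj₁ x∈ , sym p)
        many-inj : Injective _≡_ _≡_ many
        many-inj {zero}  {zero}  p = refl
        many-inj {zero}  {suc j} p = contradiction p (A≢B {0} {toℕ j})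
        many-inj {suc i} {zero}  p = contradiction (sym p) (A≢B {0} {toℕ i})
        many-inj {suc i} {suc j} p = cong suc (≋⇒≡ n (B-inj {toℕ i} {toℕ j} p))

      exclusive : ∀ {x y} → InA x → x ⟶ y → InC (h · x) → ¬ InC (h · y)
      exclusive x a (inj₁ hx) _         = hA∌A x hx
      exclusive x a (inj₂ hx) (inj₁ hy) = B⟶A hx hy (⟶-· h a)
      exclusive x a (inj₂ hx) (inj₂ hy) = hA∌A x (in-InB hy (⟶-· h a))

      hw₀∉A : ¬ InA (h · w₀)
      hw₀∉A p = exclusive (0 , refl) v₀⟶w₀ (inj₂ (0 , hv₀)) (inj₁ p)

      one-of-each-pair : ∀ j → InC (h · A j) ⊎ InC (h · B j)
      one-of-each-pair j = go (injective⇒surjective index-inj (j mod n))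
        where
        f : Fin n → V
        f = proj₁ attached
        f-common : ∀ i → InC (f i) × ∃[ x ] InC x × h · x ≡ f i
        f-common i = Equivalence.from (proj₂ (proj₂ attached) (f i)) (i , refl)
        exponent : ∀ {x} → InC x → ℕ
        exponent (inj₁ (j , _)) = j
        exponent (inj₂ (j , _)) = j
        x∈ : ∀ i → InC (proj₁ (proj₂ (f-common i)))
        x∈ i = proj₁ (proj₂ (proj₂ (f-common i)))
        index : Fin n → Fin n
        index i = exponent (x∈ i) mod n
        index-≋ : ∀ {a b} → a mod n ≡ b mod n → a ≋ b [mod n ]
        index-≋ {a} {b} p = trans (sym (toℕ-mod n a)) (trans (cong (λ i → toℕ i % n) p) (toℕ-mod n b))
        same : ∀ {x y} (p : InC x) (q : InC y) → exponent p mod n ≡ exponent q mod n →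
               InC (h · x) → InC (h · y) → x ≡ y
        same (inj₁ (j , refl)) (inj₁ (j′ , refl)) e _ _ = A-≋ (index-≋ e)
        same (inj₂ (j , refl)) (inj₂ (j′ , refl)) e _ _ = B-≋ (index-≋ e)
        same (inj₁ (j , refl)) (inj₂ (j′ , refl)) e p q = contradiction q
          (exclusive (j , refl) (subst (A j ⟶_) (B-≋ {j} {j′} (index-≋ e)) (A⟶B j)) p)
        same (inj₂ (j , refl)) (inj₁ (j′ , refl)) e p q = contradiction p
          (exclusive (j′ , refl) (subst (A j′ ⟶_) (B-≋ {j′} {j} (index-≋ (sym e))) (A⟶B j′)) q)
        h∈ : ∀ i → InC (h · proj₁ (proj₂ (f-common i)))
        h∈ i = subst InC (sym (proj₂ (proj₂ (proj₂ (f-common i))))) (proj₁ (f-common i))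
        index-inj : Injective _≡_ _≡_ index
        index-inj {i} {i′} e = proj₁ (proj₂ attached) (begin
          f i                                 ≡⟨ proj₂ (proj₂ (proj₂ (f-common i))) ⟨
          h · proj₁ (proj₂ (f-common i))      ≡⟨ cong (h ·_) (same (x∈ i) (x∈ i′) e (h∈ i) (h∈ i′)) ⟩
          h · proj₁ (proj₂ (f-common i′))     ≡⟨ proj₂ (proj₂ (proj₂ (f-common i′))) ⟩
          f i′                                ∎)
          where open ≡-Reasoning
        locate : ∀ {x} (p : InC x) → exponent p mod n ≡ j mod n → InC (h · x) → InC (h · A j) ⊎ InC (h · B j)
        locate (inj₁ (j′ , refl)) e q = inj₁ (subst (InC ∘ (h ·_)) (A-≋ {j′} {j} (index-≋ e)) q)
        locate (inj₂ (j′ , refl)) e q = inj₂ (subst (InC ∘ (h ·_)) (B-≋ {j′} {j} (index-≋ e)) q)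
        go : ∃[ i ] index i ≡ j mod n → InC (h · A j) ⊎ InC (h · B j)
        go (i , e) = locate (x∈ i) e (h∈ i)

      hA-in-C : ∀ j → InC (h · A j)
      hA-in-C zero    = inj₂ (0 , hv₀)
      hA-in-C (suc j) with one-of-each-pair (suc j)
      ... | inj₁ p = p
      ... | inj₂ p = contradiction p (exclusive (j , refl) (A⟶Bsuc j) (hA-in-C j))

      abstract
        hA-in-B : ∀ j → InB (h · A j)
        hA-in-B j with hA-in-C j
        ... | inj₁ p = contradiction p (hA∌A (j , refl))
        ... | inj₂ p = p

      fixes-next : ∀ k → k · v₀ ≡ v₀ → k · w₀ ≡ w₀ → ∀ {z} → w₀ ⟶ z → k · z ≡ z
      fixes-next k kv kw {z} a = conclude (out₀ k′w₀)
        where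
        k′ : K
        k′ = h ⁻¹ ∙ (k ∙ h)
        k′v₀ : k′ · v₀ ≡ v₀
        k′v₀ = ⁻¹-swapʳ h (trans (cong (k ·_) hv₀) (trans kw (sym hv₀)))
        k′w₀ : v₀ ⟶ k′ · w₀
        k′w₀ = subst (_⟶ k′ · w₀) k′v₀ (⟶-· k′ v₀⟶w₀)
        k′A : k′ · A 1 ≡ A 1
        k′A with hA-in-B 1
        ... | i , p = ⁻¹-swapʳ h (trans (cong (k ·_) p) (trans (proj₂ (fixes-cycle k kv kw i)) (sym p)))
        conclude : k′ · w₀ ≡ w₀ ⊎ k′ · w₀ ≡ g · w₀ → k · z ≡ z
        conclude (inj₁ q) with out-image h (sym hv₀) a | proj₂ (fixes-cycle k′ k′v₀ q 1)
        ... | inj₁ refl | _  = trans (sym (⁻¹-cancelʳ h)) (cong (h ·_) q)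
        ... | inj₂ refl | q′ = trans (sym (⁻¹-cancelʳ h)) (cong (h ·_) q′)
        conclude (inj₂ q) = contradiction
          (A-inj {0} {2} (trans (sym (proj₁ (reflects-cycle k′ k′v₀ q 1))) (cong (g ·_) k′A))) 0≢2

      faithful : ∀ k → k · v₀ ≡ v₀ → k · w₀ ≡ w₀ → ∀ z → k · z ≡ z
      faithful k kv kw z = along v₀⟶w₀ kv kw (strongly-connected w₀ z)
        where
        along : ∀ {x y z} → x ⟶ y → k · x ≡ x → k · y ≡ y → Star _⟶_ y z → k · z ≡ z
        along a kx ky ε = ky
        along {x} {y} a kx ky (_◅_ {j = y′} b bs) with transport v₀⟶w₀ a
        ... | p , refl , refl = along b ky ky′ bs
          where
          ky′ : k · y′ ≡ y′
          ky′ = trans (trans (cong (k ·_) (sym (⁻¹-cancelʳ p))) (sym (⁻¹-cancelʳ p)))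
            (trans (cong (p ·_) (fixes-next (p ⁻¹ ∙ (k ∙ p)) (⁻¹-swapʳ p kx) (⁻¹-swapʳ p ky)
              (subst (_⟶ p ⁻¹ · y′) (⁻¹-cancelˡ p) (⟶-· (p ⁻¹) b)))) (⁻¹-cancelʳ p))

      agree : ∀ k l → k · v₀ ≡ l · v₀ → k · w₀ ≡ l · w₀ → ∀ z → k · z ≡ l · z
      agree k l p q z = trans (sym (⁻¹-cancelʳ l))
        (cong (l ·_) (faithful (l ⁻¹ ∙ k) (⁻¹-swapʳ l p) (⁻¹-swapʳ l q) z))

      gⁿ≡1 : ∀ z → g ↑ n · z ≡ z
      gⁿ≡1 = faithful (g ↑ n) A-period gⁿw₀≡w₀

      g-≋ : ∀ {i j z} → i ≋ j [mod n ] → g ↑ i · z ≡ g ↑ j · z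
      g-≋ = ↑-≋ g n (gⁿ≡1 _)

      r : ℕ
      r = proj₁ (hA-in-B 1)

      hgv₀ : h · g · v₀ ≡ B r
      hgv₀ = proj₂ (hA-in-B 1)

      h-g : ∀ z → h · g · z ≡ g ↑ r · h · z
      h-g z = trans (cong (λ x → h · g · x) (sym (⁻¹-cancelˡ h)))
        (agree γ (g ↑ r) γv₀ γw₀ (h · z))
        where
        γ : K
        γ = h ∙ (g ∙ h ⁻¹)
        γw₀ : γ · w₀ ≡ B r
        γw₀ = trans (cong (λ x → h · g · x) (⁻¹-swapʳ h (sym hv₀))) hgv₀
        γv₀ : γ · v₀ ≡ A r
        γv₀ with in-B r (subst (γ · v₀ ⟶_) γw₀ (⟶-· γ v₀⟶w₀))
        ... | inj₁ p = p
        ... | inj₂ p = contradiction (A-inj {2} {0} (·-injective h hA2)) (0≢2 ∘ sym)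
          where
          κ : K
          κ = (g ↑ r) ⁻¹ ∙ (g ∙ γ)
          κw₀ : κ · w₀ ≡ g · w₀
          κw₀ = ⁻¹-swapʳ (g ↑ r) (trans (cong (g ·_) γw₀) (↑-comm g r))
          γγw₀ : γ · γ · w₀ ≡ w₀
          γγw₀ = trans (cong (γ ·_) γw₀) (·-injective g (trans (sym (⁻¹-cancelʳ (g ↑ r)))
            (proj₂ (reflects-cycle κ (⁻¹-swapʳ (g ↑ r) p) κw₀ r))))
          hA2 : h · g · g · v₀ ≡ h · v₀
          hA2 = trans (cong (λ x → h · g · x) (sym (⁻¹-cancelˡ h)))
            (trans (cong (λ x → γ · h · g · x) (sym (⁻¹-swapʳ h (sym hv₀)))) (trans γγw₀ (sym hv₀)))

      h-g↑ : ∀ j z → h · g ↑ j · z ≡ g ↑ (r * j) · h · z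
      h-g↑ zero    z = cong (λ i → g ↑ i · h · z) (sym (*-zeroʳ r))
      h-g↑ (suc j) z = begin
        h · g · g ↑ j · z             ≡⟨ h-g _ ⟩
        g ↑ r · h · g ↑ j · z         ≡⟨ cong (g ↑ r ·_) (h-g↑ j z) ⟩
        g ↑ r · g ↑ (r * j) · h · z   ≡⟨ ↑-+ g r (r * j) ⟨
        g ↑ (r + r * j) · h · z       ≡⟨ cong (λ i → g ↑ i · h · z) (*-suc r j) ⟨
        g ↑ (r * suc j) · h · z       ∎
        where open ≡-Reasoning

      h↑-g↑ : ∀ i j z → h ↑ i · g ↑ j · z ≡ g ↑ (r ^ i * j) · h ↑ i · z
      h↑-g↑ zero    j z = cong (λ a → g ↑ a · z) (sym (*-identityˡ j))
      h↑-g↑ (suc i) j z = begin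
        h · h ↑ i · g ↑ j · z               ≡⟨ cong (h ·_) (h↑-g↑ i j z) ⟩
        h · g ↑ (r ^ i * j) · h ↑ i · z     ≡⟨ h-g↑ (r ^ i * j) _ ⟩
        g ↑ (r * (r ^ i * j)) · h · h ↑ i · z ≡⟨ cong (λ a → g ↑ a · h · h ↑ i · z) (*-assoc r (r ^ i) j) ⟨
        g ↑ (r ^ suc i * j) · h · h ↑ i · z ∎
        where open ≡-Reasoning

      τ : K
      τ = proj₁ (transport v₀⟶w₀ v₀⟶gw₀)

      τv₀ : τ · v₀ ≡ v₀
      τv₀ = proj₁ (proj₂ (transport v₀⟶w₀ v₀⟶gw₀))

      τw₀ : τ · w₀ ≡ g · w₀
      τw₀ = proj₂ (proj₂ (transport v₀⟶w₀ v₀⟶gw₀))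

      τ-h : ∀ z → τ · h · z ≡ g · h · τ · z
      τ-h = agree (τ ∙ h) (g ∙ (h ∙ τ)) at-v₀ at-w₀
        where
        τhv₀ : τ · h · v₀ ≡ g · h · v₀
        τhv₀ = trans (cong (τ ·_) hv₀) (trans τw₀ (cong (g ·_) (sym hv₀)))
        at-v₀ : τ · h · v₀ ≡ g · h · τ · v₀
        at-v₀ = trans τhv₀ (cong (λ x → g · h · x) (sym τv₀))
        at-w₀ : τ · h · w₀ ≡ g · h · τ · w₀
        at-w₀ with out-image (g ∙ h) refl (subst (_⟶ τ · h · w₀) τhv₀ (⟶-· τ (⟶-· h v₀⟶w₀)))
        ... | inj₂ p = trans p (cong (λ x → g · h · x) (sym τw₀))
        ... | inj₁ p = contradiction (begin
          v₀                  ≡⟨ τv₀ ⟨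
          τ · v₀              ≡⟨ cong (τ ·_) (⁻¹-cancelʳ h) ⟨
          τ · h · h ⁻¹ · v₀   ≡⟨ agree (τ ∙ h) (g ∙ h) τhv₀ p (h ⁻¹ · v₀) ⟩
          g · h · h ⁻¹ · v₀   ≡⟨ cong (g ·_) (⁻¹-cancelʳ h) ⟩
          g · v₀              ∎) v₀≢gv₀
          where open ≡-Reasoning

      geometric : ℕ → ℕ
      geometric zero    = 0
      geometric (suc i) = suc (r * geometric i)

      τ-h↑ : ∀ i → τ · h ↑ i · v₀ ≡ g ↑ geometric i · h ↑ i · v₀
      τ-h↑ zero    = τv₀
      τ-h↑ (suc i) = begin
        τ · h · h ↑ i · v₀                          ≡⟨ τ-h _ ⟩
        g · h · τ · h ↑ i · v₀                      ≡⟨ cong (λ x → g · h · x) (τ-h↑ i) ⟩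
        g · h · g ↑ geometric i · h ↑ i · v₀        ≡⟨ cong (g ·_) (h-g↑ (geometric i) _) ⟩
        g · g ↑ (r * geometric i) · h · h ↑ i · v₀  ∎
        where open ≡-Reasoning

      InA? : Decidable InA
      InA? x = map′ (λ { (i , p) → toℕ i , p })
        (λ { (j , p) → j mod n , trans p (A-≋ (sym (toℕ-mod n j))) })
        (any? (λ i → x ≟ A (toℕ i)))

      abstract
        first-return : ∃[ m ] InA (h ↑ suc m · v₀) × (∀ {k} → k < m → ¬ InA (h ↑ suc k · v₀))
        first-return = let N , p = returns h v₀ in least (λ k → InA? (h ↑ suc k · v₀)) N (0 , p)

      m t : ℕ
      m = suc (proj₁ first-return)
      t = proj₁ (proj₁ (proj₂ first-return))

      hᵐv₀ : h ↑ m · v₀ ≡ A t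
      hᵐv₀ = proj₂ (proj₁ (proj₂ first-return))

      h↑∉A : ∀ {k} → 0 < k → k < m → ¬ InA (h ↑ k · v₀)
      h↑∉A {suc k} _ (s≤s k<m) = proj₂ (proj₂ first-return) k<m

      3≤m : 3 ≤ m
      3≤m = go (proj₁ first-return) (proj₁ (proj₂ first-return))
        where
        go : ∀ k → InA (h ↑ suc k · v₀) → 3 ≤ suc k
        go 0 (j , p) = contradiction (trans (sym p) hv₀) (A≢B {j} {0})
        go 1 p       = contradiction (subst (InA ∘ (h ·_)) hv₀ p) hw₀∉A
        go (suc (suc k)) _ = s≤s (s≤s (s≤s z≤n))

      hᵐw₀ : h ↑ m · w₀ ≡ B (r * t)
      hᵐw₀ = begin
        h ↑ m · w₀              ≡⟨ cong (h ↑ m ·_) hv₀ ⟨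
        h ↑ m · h · v₀          ≡⟨ ↑-comm h m ⟨
        h · h ↑ m · v₀          ≡⟨ cong (h ·_) hᵐv₀ ⟩
        h · A t                 ≡⟨ h-g↑ t v₀ ⟩
        g ↑ (r * t) · h · v₀    ≡⟨ cong (g ↑ (r * t) ·_) hv₀ ⟩
        B (r * t)               ∎
        where open ≡-Reasoning

      hᵐgw₀ : h ↑ m · g · w₀ ≡ B (r ^ m + r * t)
      hᵐgw₀ = begin
        h ↑ m · g ↑ 1 · w₀                ≡⟨ h↑-g↑ m 1 w₀ ⟩
        g ↑ (r ^ m * 1) · h ↑ m · w₀      ≡⟨ cong₂ (λ a x → g ↑ a · x) (*-identityʳ (r ^ m)) hᵐw₀ ⟩
        g ↑ (r ^ m) · B (r * t)           ≡⟨ ↑-+ g (r ^ m) (r * t) ⟨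
        B (r ^ m + r * t)                 ∎
        where open ≡-Reasoning

      rᵐ≢0 : ¬ r ^ m + r * t ≋ r * t [mod n ]
      rᵐ≢0 p = w₀≢gw₀ (·-injective (h ↑ m) (trans hᵐw₀ (trans (B-≋ (sym p)) (sym hᵐgw₀))))

      -- h^m maps the arcs leaving v₀ to those leaving A t; it may or may not swap their order.
      return-cases : (r * t ≋ t [mod n ] × r ^ m ≋ 1 [mod n ])
                   ⊎ (r * t ≋ suc t [mod n ] × suc (r ^ m) ≋ 0 [mod n ])
      return-cases with out-A t (subst₂ _⟶_ hᵐv₀ hᵐw₀ (⟶-· (h ↑ m) v₀⟶w₀))
                      | out-A t (subst₂ _⟶_ hᵐv₀ hᵐgw₀ (⟶-· (h ↑ m) v₀⟶gw₀))
      ... | inj₁ p | inj₁ q = contradiction (B-inj (trans q (sym p))) rᵐ≢0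
      ... | inj₂ p | inj₂ q = contradiction (B-inj (trans q (sym p))) rᵐ≢0
      ... | inj₁ p | inj₂ q = inj₁ (B-inj p , ≋-+-cancelˡ n t (begin
        (t + r ^ m) % n      ≡⟨ ≋-+ n {b = r ^ m} (sym (B-inj p)) refl ⟩
        (r * t + r ^ m) % n  ≡⟨ cong (_% n) (+-comm (r * t) (r ^ m)) ⟩
        (r ^ m + r * t) % n  ≡⟨ B-inj q ⟩
        suc t % n            ≡⟨ cong (_% n) (+-comm 1 t) ⟩
        (t + 1) % n          ∎))
        where open ≡-Reasoning
      ... | inj₂ p | inj₁ q = inj₂ (B-inj p , ≋-+-cancelˡ n t (begin
        (t + suc (r ^ m)) % n   ≡⟨ cong (_% n) (+-suc t (r ^ m)) ⟩
        (suc t + r ^ m) % n     ≡⟨ ≋-+ n {b = r ^ m} (sym (B-inj p)) refl ⟩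
        (r * t + r ^ m) % n     ≡⟨ cong (_% n) (+-comm (r * t) (r ^ m)) ⟩
        (r ^ m + r * t) % n     ≡⟨ B-inj q ⟩
        t % n                   ≡⟨ cong (_% n) (+-identityʳ t) ⟨
        (t + 0) % n             ∎))
        where open ≡-Reasoning

      φ : ℕ → ℕ → V
      φ i j = g ↑ j · h ↑ i · v₀

      φ-next : ∀ i j → g ↑ j · h ↑ i · w₀ ≡ φ (suc i) j
      φ-next i j = cong (g ↑ j ·_) (trans (cong (h ↑ i ·_) (sym hv₀)) (sym (↑-comm h i)))

      φ-next′ : ∀ i j → g ↑ j · h ↑ i · g · w₀ ≡ φ (suc i) (j + r ^ i)
      φ-next′ i j = begin
        g ↑ j · h ↑ i · g ↑ 1 · w₀              ≡⟨ cong (g ↑ j ·_) (h↑-g↑ i 1 w₀) ⟩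
        g ↑ j · g ↑ (r ^ i * 1) · h ↑ i · w₀    ≡⟨ cong (λ a → g ↑ j · g ↑ a · h ↑ i · w₀) (*-identityʳ (r ^ i)) ⟩
        g ↑ j · g ↑ (r ^ i) · h ↑ i · w₀        ≡⟨ ↑-+ g j (r ^ i) ⟨
        g ↑ (j + r ^ i) · h ↑ i · w₀            ≡⟨ φ-next i (j + r ^ i) ⟩
        φ (suc i) (j + r ^ i)                   ∎
        where open ≡-Reasoning

      φ-wrap : ∀ j → φ m j ≡ φ 0 (j + t)
      φ-wrap j = trans (cong (g ↑ j ·_) hᵐv₀) (sym (↑-+ g j t))

      φ-≋ : ∀ i {j j′} → j ≋ j′ [mod n ] → φ i j ≡ φ i j′
      φ-≋ i = g-≋

      φ⟶ : ∀ i j {z} → z ≡ φ (suc i) j ⊎ z ≡ φ (suc i) (j + r ^ i) → φ i j ⟶ z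
      φ⟶ i j (inj₁ refl) = subst (φ i j ⟶_) (φ-next i j) (⟶-· (g ↑ j) (⟶-· (h ↑ i) v₀⟶w₀))
      φ⟶ i j (inj₂ refl) = subst (φ i j ⟶_) (φ-next′ i j) (⟶-· (g ↑ j) (⟶-· (h ↑ i) v₀⟶gw₀))

      out-φ : ∀ i j {z} → φ i j ⟶ z → z ≡ φ (suc i) j ⊎ z ≡ φ (suc i) (j + r ^ i)
      out-φ i j a with out-image (g ↑ j ∙ h ↑ i) refl a
      ... | inj₁ p = inj₁ (trans p (φ-next i j))
      ... | inj₂ p = inj₂ (trans p (φ-next′ i j))

      φ-surjective : ∀ z → ∃[ i ] ∃[ j ] i < m × z ≡ φ i j
      φ-surjective z = along {0} {0} (s≤s z≤n) refl (strongly-connected v₀ z)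
        where
        reduce : ∀ {i j} → i < m → ∃[ i′ ] ∃[ j′ ] i′ < m × φ (suc i) j ≡ φ i′ j′
        reduce {i} {j} i<m with m≤n⇒m<n∨m≡n i<m
        ... | inj₁ i+1<m = suc i , j , i+1<m , refl
        ... | inj₂ refl  = 0 , j + t , s≤s z≤n , φ-wrap j
        along : ∀ {i j x z} → i < m → x ≡ φ i j → Star _⟶_ x z → ∃[ i′ ] ∃[ j′ ] i′ < m × z ≡ φ i′ j′
        along {i} {j} i<m p ε = i , j , i<m , p
        along {i} {j} i<m refl (a ◅ as) with out-φ i j a
        ... | inj₁ p = let i′ , j′ , l , q = reduce {i} {j} i<m in along {i′} {j′} l (trans p q) as
        ... | inj₂ p = let i′ , j′ , l , q = reduce {i} {j + r ^ i} i<m in along {i′} {j′} l (trans p q) as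

      φ-shift : ∀ d i j → h ↑ d · φ i j ≡ φ (d + i) (r ^ d * j)
      φ-shift d i j = trans (h↑-g↑ d j _) (cong (g ↑ (r ^ d * j) ·_) (sym (↑-+ h d i)))

      φ-≮ : ∀ {i i′ j j′} → i′ < m → φ i j ≡ φ i′ j′ → ¬ i < i′
      φ-≮ {i} {i′} {j} {j′} i′<m p i<i′ = h↑∉A {d + i}
        (≤-trans (m<n⇒0<n∸m i′<m) (m≤m+n d i))
        (≤-trans (+-monoʳ-< d i<i′) (≤-reflexive (m∸n+n≡m (<⇒≤ i′<m))))
        (InA-back (r ^ d * j) (subst InA q (InA-forth (r ^ d * j′) (t , hᵐv₀))))
        where
        d = m ∸ i′
        q : φ m (r ^ d * j′) ≡ φ (d + i) (r ^ d * j)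
        q = trans (cong (λ a → φ a (r ^ d * j′)) (sym (m∸n+n≡m (<⇒≤ i′<m))))
          (trans (sym (φ-shift d i′ j′)) (trans (cong (h ↑ d ·_) (sym p)) (φ-shift d i j)))

      φ-injective₁ : ∀ {i i′ j j′} → i < m → i′ < m → φ i j ≡ φ i′ j′ → i ≡ i′
      φ-injective₁ {j = j} {j′} i<m i′<m p =
        ≤-antisym (≮⇒≥ (φ-≮ {j = j′} {j} i<m (sym p))) (≮⇒≥ (φ-≮ {j = j} {j′} i′<m p))

      module EvenRadius (2∣n : 2 ∣ n) where

        r*t≋t×r^m≋1 : r * t ≋ t [mod n ] × r ^ m ≋ 1 [mod n ]
        r*t≋t×r^m≋1 with return-cases
        ... | inj₁ p = p
        ... | inj₂ (p , q) = contradiction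
          (trans (sym (≋-* 2 {r} {1} {t} {t} r-odd refl)) (≋⇒≋2 2∣n p))
          (subst (λ a → ¬ a ≋ suc t [mod 2 ]) (sym (*-identityˡ t)) (suc≋̸2 t))
          where
          r-odd : r ≋ 1 [mod 2 ]
          r-odd = odd-base r (proj₁ first-return) (≋-+-cancelˡ 2 1 {r ^ m} {1} (≋⇒≋2 2∣n q))

        r^m≋1 : r ^ m ≋ 1 [mod n ]
        r^m≋1 = proj₂ r*t≋t×r^m≋1

        r*t≋t : r * t ≋ t [mod n ]
        r*t≋t = proj₁ r*t≋t×r^m≋1

        r-odd : r ≋ 1 [mod 2 ]
        r-odd = odd-base r (proj₁ first-return) (≋⇒≋2 2∣n r^m≋1)

        geometric+2t≋0 : geometric m + (t + t) ≋ 0 [mod n ]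
        geometric+2t≋0 = A-inj (begin
          A (geometric m + (t + t))                 ≡⟨ cong A (trans (sym (+-assoc (geometric m) t t))
                                                         (+-comm (geometric m + t) t)) ⟩
          A (t + (geometric m + t))                 ≡⟨ ↑-+ g t (geometric m + t) ⟩
          g ↑ t · A (geometric m + t)               ≡⟨ cong (g ↑ t ·_) (↑-+ g (geometric m) t) ⟩
          g ↑ t · g ↑ geometric m · A t             ≡⟨ cong (λ x → g ↑ t · g ↑ geometric m · x) hᵐv₀ ⟨
          g ↑ t · g ↑ geometric m · h ↑ m · v₀      ≡⟨ cong (g ↑ t ·_) (τ-h↑ m) ⟨
          g ↑ t · τ · h ↑ m · v₀                    ≡⟨ cong (λ x → g ↑ t · τ · x) hᵐv₀ ⟩
          g ↑ t · τ · A t                           ≡⟨ proj₁ (reflects-cycle τ τv₀ τw₀ t) ⟩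
          v₀                                        ∎)
          where open ≡-Reasoning

        geometric-parity : ∀ i → geometric i ≋ i [mod 2 ]
        geometric-parity zero    = refl
        geometric-parity (suc i) = ≋-+ 2 {1} {1} {r * geometric i} {i} refl
          (trans (≋-* 2 {r} {1} {geometric i} {i} r-odd (geometric-parity i))
          (cong (_% 2) (*-identityˡ i)))

        2∣m : 2 ∣ m
        2∣m = m%n≡0⇒n∣m m 2 (trans (sym (geometric-parity m))
          (trans (cong (_% 2) (sym (+-identityʳ (geometric m))))
          (trans (≋-+ 2 {geometric m} {geometric m} {0} {t + t} refl (sym t+t≋0)) (≋⇒≋2 2∣n geometric+2t≋0))))
          where
          t+t≋0 : t + t ≋ 0 [mod 2 ]
          t+t≋0 = trans (cong (λ a → (t + a) % 2) (sym (+-identityʳ t))) (n*a≋0 2 t)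

        4≤m : 4 ≤ m
        4≤m = go m 3≤m 2∣m
          where
          go : ∀ a → 3 ≤ a → 2 ∣ a → 4 ≤ a
          go 0 () _
          go 1 (s≤s ()) _
          go 2 (s≤s (s≤s ())) _
          go 3 _ (divides zero ())
          go 3 _ (divides (suc zero) ())
          go 3 _ (divides (suc (suc _)) ())
          go (suc (suc (suc (suc a)))) _ _ = s≤s (s≤s (s≤s (s≤s z≤n)))

        φ-injective₂ : ∀ {i j j′} → i < m → φ i j ≡ φ i j′ → j ≋ j′ [mod n ]
        φ-injective₂ {i} {j} {j′} i<m p = trans (sym (cancel j)) (trans (≋-* n {r ^ i} refl q) (cancel j′))
          where
          open ≡-Reasoning
          d = m ∸ i
          at-m : ∀ j → h ↑ d · φ i j ≡ A (t + r ^ d * j)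
          at-m j = trans (φ-shift d i j) (trans (cong (λ a → φ a (r ^ d * j)) (m∸n+n≡m (<⇒≤ i<m)))
            (trans (φ-wrap (r ^ d * j)) (cong A (+-comm (r ^ d * j) t))))
          q : r ^ d * j ≋ r ^ d * j′ [mod n ]
          q = ≋-+-cancelˡ n t (A-inj (trans (sym (at-m j)) (trans (cong (h ↑ d ·_) p) (at-m j′))))
          cancel : ∀ j → r ^ i * (r ^ d * j) ≋ j [mod n ]
          cancel j = begin
            (r ^ i * (r ^ d * j)) % n    ≡⟨ cong (_% n) (*-assoc (r ^ i) (r ^ d) j) ⟨
            (r ^ i * r ^ d * j) % n      ≡⟨ cong (λ a → (a * j) % n) (^-distribˡ-+-* r i d) ⟨
            (r ^ (i + d) * j) % n        ≡⟨ cong (λ a → (r ^ a * j) % n) (m+[n∸m]≡n (<⇒≤ i<m)) ⟩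
            (r ^ m * j) % n              ≡⟨ ≋-* n {b = j} r^m≋1 refl ⟩
            (1 * j) % n                  ≡⟨ cong (_% n) (*-identityˡ j) ⟩
            j % n                        ∎

        open IntegersModulo n
        open RawRing (ℤ/ n) using (1#; 0#; -_; rawSemiring) renaming (_+_ to _⊕_; _*_ to _⊛_)
        open RawSemiringDefs rawSemiring using (sum) renaming (_^_ to _⊛^_)

        rᶠ tᶠ : Fin n
        rᶠ = r mod n
        tᶠ = t mod n

        rᶠ≋r : toℕ rᶠ ≋ r [mod n ]
        rᶠ≋r = toℕ-mod n r

        tᶠ≋t : toℕ tᶠ ≋ t [mod n ]
        tᶠ≋t = toℕ-mod n t

        rᶠ^m≡1 : rᶠ ⊛^ m ≡ 1#
        rᶠ^m≡1 = ≋⇒≡ n (trans (toℕ-^ rᶠ≋r m) (trans r^m≋1 (sym (toℕ-mod n 1))))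

        tᶠ[rᶠ-1]≡0 : tᶠ ⊛ (rᶠ ⊕ (- 1#)) ≡ 0#
        tᶠ[rᶠ-1]≡0 = ≋⇒≡ n (begin
          toℕ (tᶠ ⊛ (rᶠ ⊕ (- 1#))) % n              ≡⟨ toℕ-⊛ tᶠ (rᶠ ⊕ (- 1#)) ⟩
          (toℕ tᶠ * toℕ (rᶠ ⊕ (- 1#))) % n          ≡⟨ ≋-* n {toℕ tᶠ} {t} tᶠ≋t (trans (toℕ-⊕ rᶠ (- 1#))
                                                         (≋-+ n rᶠ≋r (toℕ-mod n (n ∸ toℕ 1#)))) ⟩
          (t * (r + (n ∸ toℕ 1#))) % n              ≡⟨ cong (λ a → (t * (r + (n ∸ a))) % n) toℕ-1# ⟩
          (t * (r + pred n)) % n                    ≡⟨ cong (_% n) (*-distribˡ-+ t r (pred n)) ⟩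
          (t * r + t * pred n) % n                  ≡⟨ ≋-+ n {t * r} {t} {t * pred n} (trans (cong (_% n) (*-comm t r)) r*t≋t) refl ⟩
          (t + t * pred n) % n                      ≡⟨ cong (_% n) (*-suc t (pred n)) ⟨
          (t * suc (pred n)) % n                    ≡⟨ cong (_% n) (trans (cong (t *_) (suc-pred n)) (*-comm t n)) ⟩
          (n * t) % n                               ≡⟨ n*a≋0 n t ⟩
          0 % n                                     ≡⟨ toℕ-mod n 0 ⟨
          toℕ {n} 0# % n                            ∎)
          where
          open ≡-Reasoning
          toℕ-1# : toℕ {n} 1# ≡ 1
          toℕ-1# = trans (toℕ-fromℕ< (m%n<n 1 n)) (m<n⇒m%n≡m (≤-trans (s≤s (s≤s z≤n)) 4≤n))

        sum-powers≋geometric : ∀ k → toℕ (sum {k} (λ l → rᶠ ⊛^ toℕ l)) ≋ geometric k [mod n ]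
        sum-powers≋geometric zero    = toℕ-mod n 0
        sum-powers≋geometric (suc k) = trans (sum-powers-suc {rᶠ} {r} rᶠ≋r k)
          (≋-+ n {1} {1} {r * toℕ (sum {k} (λ l → rᶠ ⊛^ toℕ l))} {r * geometric k} refl
            (≋-* n {r} {r} {toℕ (sum {k} (λ l → rᶠ ⊛^ toℕ l))} refl (sum-powers≋geometric k)))

        sum+2tᶠ≡0 : sum {m} (λ l → rᶠ ⊛^ toℕ l) ⊕ (tᶠ ⊕ tᶠ) ≡ 0#
        sum+2tᶠ≡0 = ≋⇒≡ n (begin
          toℕ (Σr ⊕ (tᶠ ⊕ tᶠ)) % n            ≡⟨ toℕ-⊕ Σr (tᶠ ⊕ tᶠ) ⟩
          (toℕ Σr + toℕ (tᶠ ⊕ tᶠ)) % n        ≡⟨ ≋-+ n {toℕ Σr} {geometric m} (sum-powers≋geometric m)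
                                                   (trans (toℕ-⊕ tᶠ tᶠ) (≋-+ n tᶠ≋t tᶠ≋t)) ⟩
          (geometric m + (t + t)) % n         ≡⟨ geometric+2t≋0 ⟩
          0 % n                               ≡⟨ toℕ-mod n 0 ⟨
          toℕ {n} 0# % n                      ∎)
          where
          open ≡-Reasoning
          Σr = sum {m} (λ l → rᶠ ⊛^ toℕ l)

        parameters : Parameters
        parameters = record
          { m = m ; n = n ; m-even = 2∣m ; n-even = 2∣n ; 4≤m = 4≤m ; 4≤n = 4≤n
          ; r = rᶠ ; t = tᶠ
          ; r-unit   = rᶠ ⊛^ pred m , rᶠ^m≡1
          ; r^m≡1    = rᶠ^m≡1
          ; t[r-1]≡0 = tᶠ[rᶠ-1]≡0
          ; sum+2t≡0 = sum+2tᶠ≡0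
          }

        vertex : Fin m × Fin n → V
        vertex (i , j) = φ (toℕ i) (toℕ j)

        vertex-injective : ∀ {p q} → vertex p ≡ vertex q → p ≡ q
        vertex-injective {i , j} {i′ , j′} eq = cong₂ _,_ (toℕ-injective i≡i′)
          (≋⇒≡ n (φ-injective₂ {toℕ i} {toℕ j} {toℕ j′} (toℕ<n i)
            (trans eq (cong (λ a → φ a (toℕ j′)) (sym i≡i′)))))
          where
          i≡i′ : toℕ i ≡ toℕ i′
          i≡i′ = φ-injective₁ {j = toℕ j} {toℕ j′} (toℕ<n i) (toℕ<n i′) eq

        coordinates : V → Fin m × Fin n
        coordinates z = let i , j , i<m , _ = φ-surjective z in fromℕ< i<m , j mod n

        vertex-coordinates : ∀ z → vertex (coordinates z) ≡ z
        vertex-coordinates z = let i , j , i<m , p = φ-surjective z in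
          trans (cong (λ a → φ a (toℕ (j mod n))) (toℕ-fromℕ< i<m))
            (trans (φ-≋ i (toℕ-mod n j)) (sym p))

        φ-⊕ : ∀ i j k {a} → toℕ k ≋ a [mod n ] → φ i (toℕ (j ⊕ k)) ≡ φ i (toℕ j + a)
        φ-⊕ i j k {a} p = φ-≋ i (trans (toℕ-⊕ j k) (≋-+ n {toℕ j} {toℕ j} {toℕ k} {a} refl p))

        φ-⊕^ : ∀ i j l → φ i (toℕ (j ⊕ rᶠ ⊛^ l)) ≡ φ i (toℕ j + r ^ l)
        φ-⊕^ i j l = φ-⊕ i j (rᶠ ⊛^ l) (toℕ-^ rᶠ≋r l)

        φ-wrapᶠ : ∀ j → φ 0 (toℕ (j ⊕ tᶠ)) ≡ φ m (toℕ j)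
        φ-wrapᶠ j = trans (φ-⊕ 0 j tᶠ tᶠ≋t) (sym (φ-wrap (toℕ j)))

        step⇒⟶ : ∀ {p q} → Step parameters p q → vertex p ⟶ vertex q
        step⇒⟶ (inner {i} {i′} {j} {j′} i′≡ (inj₁ refl)) =
          φ⟶ (toℕ i) (toℕ j) (inj₁ (cong (λ a → φ a (toℕ j)) i′≡))
        step⇒⟶ (inner {i} {i′} {j} {j′} i′≡ (inj₂ refl)) =
          φ⟶ (toℕ i) (toℕ j) (inj₂ (trans (cong (λ a → φ a (toℕ j′)) i′≡) (φ-⊕^ (suc (toℕ i)) j (toℕ i))))
        step⇒⟶ (wrap {i} {i′} {j} {j′} i≡ i′≡ (inj₁ refl)) =
          φ⟶ (toℕ i) (toℕ j) (inj₁ (trans (cong (λ a → φ a (toℕ j′)) i′≡)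
            (trans (φ-wrapᶠ j) (cong (λ a → φ (suc a) (toℕ j)) (sym i≡)))))
        step⇒⟶ (wrap {i} {i′} {j} {j′} i≡ i′≡ (inj₂ refl)) =
          φ⟶ (toℕ i) (toℕ j) (inj₂ (begin
            φ (toℕ i′) (toℕ j′)                              ≡⟨ cong (λ a → φ a (toℕ j′)) i′≡ ⟩
            φ 0 (toℕ ((j ⊕ rᶠ ⊛^ pred m) ⊕ tᶠ))              ≡⟨ φ-wrapᶠ (j ⊕ rᶠ ⊛^ pred m) ⟩
            φ m (toℕ (j ⊕ rᶠ ⊛^ pred m))                     ≡⟨ φ-⊕^ m j (pred m) ⟩
            φ m (toℕ j + r ^ pred m)                         ≡⟨ cong (λ a → φ (suc a) (toℕ j + r ^ a)) i≡ ⟨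
            φ (suc (toℕ i)) (toℕ j + r ^ toℕ i)              ∎))
          where open ≡-Reasoning

        Is-Step : Fin m × Fin n → V → Set
        Is-Step p z = ∃[ q ] vertex q ≡ z × Step parameters p q

        step-to : ∀ i j k → k ≡ j ⊎ k ≡ j ⊕ rᶠ ⊛^ toℕ i → Is-Step (i , j) (φ (suc (toℕ i)) (toℕ k))
        step-to i j k c with m≤n⇒m<n∨m≡n (toℕ<n i)
        ... | inj₁ i+1<m = (fromℕ< i+1<m , k) , cong (λ a → φ a (toℕ k)) (toℕ-fromℕ< i+1<m) ,
                           inner (toℕ-fromℕ< i+1<m) c
        ... | inj₂ i+1≡m = (zero , k ⊕ tᶠ) , trans (φ-wrapᶠ k) (cong (λ a → φ a (toℕ k)) (sym i+1≡m)) ,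
                           wrap (cong pred i+1≡m) refl (wrap-case c)
          where
          wrap-case : k ≡ j ⊎ k ≡ j ⊕ rᶠ ⊛^ toℕ i →
                      k ⊕ tᶠ ≡ j ⊕ tᶠ ⊎ k ⊕ tᶠ ≡ (j ⊕ rᶠ ⊛^ pred m) ⊕ tᶠ
          wrap-case (inj₁ p) = inj₁ (cong (_⊕ tᶠ) p)
          wrap-case (inj₂ p) = inj₂ (cong (_⊕ tᶠ) (trans p (cong (λ a → j ⊕ rᶠ ⊛^ a) (cong pred i+1≡m))))

        ⟶⇒is-step : ∀ p {z} → vertex p ⟶ z → Is-Step p z
        ⟶⇒is-step (i , j) a with out-φ (toℕ i) (toℕ j) a
        ... | inj₁ refl = step-to i j j (inj₁ refl)
        ... | inj₂ refl = subst (Is-Step (i , j)) (φ-⊕^ (suc (toℕ i)) j (toℕ i)) (step-to i j _ (inj₂ refl))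

        ⟶⇒step : ∀ {p q} → vertex p ⟶ vertex q → Step parameters p q
        ⟶⇒step {p} {q} a with ⟶⇒is-step p a
        ... | q′ , eq , s = subst (Step parameters p) (vertex-injective eq) s

        isomorphism : X ≅ 𝒳ₑ parameters
        isomorphism = record
          { bij     = mk↔ₛ′ coordinates vertex
                        (λ p → vertex-injective (vertex-coordinates (vertex p))) vertex-coordinates
          ; adj-iff = λ u v → mk⇔
              ([ fwd ∘ ⟶⇒step ∘ subst₂ _⟶_ (sym (vertex-coordinates u)) (sym (vertex-coordinates v))
               , bwd ∘ ⟶⇒step ∘ subst₂ _⟶_ (sym (vertex-coordinates v)) (sym (vertex-coordinates u)) ]′ ∘ Adj⇒⟶)
              λ { (fwd s) → ⟶⇒Adj (subst₂ _⟶_ (vertex-coordinates u) (vertex-coordinates v) (step⇒⟶ s))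
                ; (bwd s) → adj-sym X (⟶⇒Adj (subst₂ _⟶_ (vertex-coordinates v) (vertex-coordinates u) (step⇒⟶ s))) }
          }

  module CycleToOrbits
    (n : ℕ) .{{_ : NonZero n}} (4≤n : 4 ≤ n)
    (C : Cycle X) (alt : Alternating G o C) (len≡2n : Cycle.len C ≡ 2 * n)
    where
    open Cycle C

    private instance
      len-nonZero : NonZero len
      len-nonZero = len≢0

    Tail Head : Fin len → Set
    Tail = IsTail G o C
    Head = IsHead G o C

    ¬Tail×Head : ∀ {i} → Tail i → ¬ Head i
    ¬Tail×Head t h = ⟶-asym (proj₁ t) (proj₁ h)

    Tail⇒Head-next : ∀ {i} → Tail i → Head (next i)
    Tail⇒Head-next {i} t with proj₂ alt i
    ... | inj₁ (_ , h) = h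
    ... | inj₂ (h , _) = contradiction h (¬Tail×Head t)

    Head⇒Tail-next : ∀ {i} → Head i → Tail (next i)
    Head⇒Tail-next {i} h with proj₂ alt i
    ... | inj₁ (t , _) = contradiction h (¬Tail×Head t)
    ... | inj₂ (_ , t) = t

    tail-exists : ∃[ i ] Tail i
    tail-exists with proj₂ alt (0 mod len)
    ... | inj₁ (t , _) = 0 mod len , t
    ... | inj₂ (_ , t) = next (0 mod len) , t

    i₀ : Fin len
    i₀ = proj₁ tail-exists

    p : ℕ → Fin len
    p zero    = i₀
    p (suc j) = next (next (p j))

    a b : ℕ → V
    a j = vertex (p j)
    b j = vertex (next (p j))

    p-Tail : ∀ j → Tail (p j)
    p-Tail zero    = proj₂ tail-exists
    p-Tail (suc j) = Head⇒Tail-next (Tail⇒Head-next (p-Tail j))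

    a⟶b : ∀ j → a j ⟶ b j
    a⟶b j = proj₁ (p-Tail j)

    asuc⟶b : ∀ j → a (suc j) ⟶ b j
    asuc⟶b j = proj₁ (Tail⇒Head-next (p-Tail j))

    toℕ-next : ∀ i → toℕ (next i) ≋ suc (toℕ i) [mod len ]
    toℕ-next i = trans (toℕ-mod len _)
      (trans (≋-+ len {toℕ i} refl (toℕ-mod len 1)) (cong (_% len) (+-comm (toℕ i) 1)))

    toℕ-p : ∀ j → toℕ (p j) ≋ toℕ i₀ + 2 * j [mod len ]
    toℕ-p zero    = cong (_% len) (sym (+-identityʳ (toℕ i₀)))
    toℕ-p (suc j) = begin
      toℕ (next (next (p j))) % len     ≡⟨ toℕ-next (next (p j)) ⟩
      suc (toℕ (next (p j))) % len      ≡⟨ ≋-+ len {1} refl (toℕ-next (p j)) ⟩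
      suc (suc (toℕ (p j))) % len       ≡⟨ ≋-+ len {2} {2} {toℕ (p j)} {toℕ i₀ + 2 * j} refl (toℕ-p j) ⟩
      (2 + (toℕ i₀ + 2 * j)) % len      ≡⟨ cong (_% len) (+-assoc 2 (toℕ i₀) (2 * j)) ⟨
      (2 + toℕ i₀ + 2 * j) % len        ≡⟨ cong (λ x → (x + 2 * j) % len) (+-comm 2 (toℕ i₀)) ⟩
      (toℕ i₀ + 2 + 2 * j) % len        ≡⟨ cong (_% len) (+-assoc (toℕ i₀) 2 (2 * j)) ⟩
      (toℕ i₀ + (2 + 2 * j)) % len      ≡⟨ cong (λ x → (toℕ i₀ + x) % len) (*-suc 2 j) ⟨
      (toℕ i₀ + 2 * suc j) % len        ∎
      where open ≡-Reasoning

    toℕ-next-p : ∀ j → toℕ (next (p j)) ≋ suc (toℕ i₀ + 2 * j) [mod len ]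
    toℕ-next-p j = trans (toℕ-next (p j)) (≋-+ len {1} {1} {toℕ (p j)} refl (toℕ-p j))

    p-≋ : ∀ {i j} → i ≋ j [mod n ] → p i ≡ p j
    p-≋ {i} {j} i≋j = ≋⇒≡ len (trans (toℕ-p i) (trans (≋-+ len {toℕ i₀} refl (2*-≋ len≡2n i≋j)) (sym (toℕ-p j))))

    a-inj : ∀ {i j} → a i ≡ a j → i ≋ j [mod n ]
    a-inj {i} {j} e = 2*-≋-cancel len≡2n (≋-+-cancelˡ len (toℕ i₀)
      (trans (sym (toℕ-p i)) (trans (cong (λ x → toℕ x % len) (injective e)) (toℕ-p j))))

    b-inj : ∀ {i j} → b i ≡ b j → i ≋ j [mod n ]
    b-inj {i} {j} e = 2*-≋-cancel len≡2n (≋-+-cancelˡ len (suc (toℕ i₀))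
      (trans (sym (toℕ-next-p i)) (trans (cong (λ x → toℕ x % len) (injective e)) (toℕ-next-p j))))

    a≢b : ∀ {i j} → a i ≢ b j
    a≢b {i} {j} e = ¬Tail×Head (p-Tail i) (subst Head (sym (injective e)) (Tail⇒Head-next (p-Tail j)))

    cover : ∀ i → (∃[ j ] vertex i ≡ a (suc j)) ⊎ (∃[ j ] vertex i ≡ b j)
    cover i = go (m≡m%n+[m/n]*n k 2) (even-or-odd k)
      where
      k q : ℕ
      k = len + toℕ i ∸ toℕ i₀
      q = k / 2
      i₀+k≋i : toℕ i₀ + k ≋ toℕ i [mod len ]
      i₀+k≋i = trans (cong (_% len) (m+[n∸m]≡n (≤-trans (<⇒≤ (toℕ<n i₀)) (m≤m+n len (toℕ i)))))
        (trans (cong (_% len) (+-comm len (toℕ i))) ([m+n]%n≡m%n (toℕ i) len))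
      go : k ≡ k % 2 + q * 2 → k ≋ 0 [mod 2 ] ⊎ k ≋ 1 [mod 2 ] →
           (∃[ j ] vertex i ≡ a (suc j)) ⊎ (∃[ j ] vertex i ≡ b j)
      go k≡ (inj₁ even) = inj₁ (pred n + q , cong vertex (trans
        (≋⇒≡ len (trans (sym i₀+k≋i) (trans (cong (λ x → (toℕ i₀ + x) % len)
          (trans k≡ (trans (cong (_+ q * 2) even) (*-comm q 2)))) (sym (toℕ-p q)))))
        (sym (p-≋ (trans (cong (λ x → (x + q) % n) (suc-pred n))
          (trans (cong (_% n) (+-comm n q)) ([m+n]%n≡m%n q n)))))))
      go k≡ (inj₂ odd) = inj₂ (q , cong vertex
        (≋⇒≡ len (trans (sym i₀+k≋i) (trans (cong (_% len)
          (trans (cong (toℕ i₀ +_) (trans k≡ (trans (cong (_+ q * 2) odd) (cong suc (*-comm q 2)))))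
            (+-suc (toℕ i₀) (2 * q))))
          (sym (toℕ-next-p q))))))

    j≋̸suc : ∀ {j} → ¬ j ≋ suc j [mod n ]
    j≋̸suc {j} e with () ← small-≋ (≤-trans (s≤s z≤n) 4≤n) (≤-trans (s≤s (s≤s z≤n)) 4≤n)
      (≋-+-cancelˡ n j {0} {1} (trans (cong (_% n) (+-identityʳ j)) (trans e (cong (_% n) (+-comm 1 j)))))

    b≢bsuc : ∀ {j} → b j ≢ b (suc j)
    b≢bsuc {j} e = j≋̸suc (b-inj {j} {suc j} e)

    a≢asuc : ∀ {j} → a j ≢ a (suc j)
    a≢asuc {j} e = j≋̸suc (a-inj {j} {suc j} e)

    open Valency (asuc⟶b 0) (a⟶b 1) (b≢bsuc {0}) (a⟶b 1) (asuc⟶b 1) (a≢asuc {1})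

    rotation : ∃[ g ] g · a 1 ≡ a 2 × g · b 0 ≡ b 1
    rotation = transport (asuc⟶b 0) (asuc⟶b 1)

    g : K
    g = proj₁ rotation

    g-rotates : ∀ j → g · a (suc j) ≡ a (2 + j) × g · b j ≡ b (suc j)
    g-rotates = zigzag-shift a⟶b asuc⟶b (λ j → a≢asuc {j}) (λ j → b≢bsuc {j}) g
      (proj₁ (proj₂ rotation)) (proj₂ (proj₂ rotation))

    v₀ w₀ : V
    v₀ = a 1
    w₀ = b 0

    g↑v₀ : ∀ j → g ↑ j · v₀ ≡ a (suc j)
    g↑v₀ zero    = refl
    g↑v₀ (suc j) = trans (cong (g ·_) (g↑v₀ j)) (proj₁ (g-rotates j))

    g↑w₀ : ∀ j → g ↑ j · w₀ ≡ b j
    g↑w₀ zero    = refl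
    g↑w₀ (suc j) = trans (cong (g ·_) (g↑w₀ j)) (proj₂ (g-rotates j))

    h : K
    h = proj₁ (move v₀ w₀)

    hv₀ : h · v₀ ≡ w₀
    hv₀ = proj₂ (move v₀ w₀)

    hC : Cycle X
    hC = record
      { len       = len
      ; 3≤len     = 3≤len
      ; vertex    = λ i → h · vertex i
      ; injective = λ e → injective (·-injective h e)
      ; adjacent  = λ i → Equivalence.to (_≅_.adj-iff (proj₁ h) _ _) (adjacent i)
      }

    hC-alternating : Alternating G o hC
    hC-alternating = proj₁ alt , λ i → Sum.map
      (Product.map (both i) (both′ (next i))) (Product.map (both′ i) (both (next i))) (proj₂ alt i)
      where
      both : ∀ i → Tail i → IsTail G o hC i
      both i (x , y) = ⟶-· h x , ⟶-· h y
      both′ : ∀ i → Head i → IsHead G o hC i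
      both′ i (x , y) = ⟶-· h x , ⟶-· h y

    C≉hC : ¬ (C ≈ᶜ hC)
    C≉hC same with Equivalence.to (same v₀ w₀) (next (p 0) , inj₂ (refl , refl))
    ... | i , inj₂ (e , e′) = ⟶-asym (asuc⟶b 0)
          (subst₂ _⟶_ e e′ (⟶-· h (proj₁ (subst Tail (sym i≡p1) (p-Tail 1)))))
          where
          i≡p1 : i ≡ p 1
          i≡p1 = injective (·-injective h (trans e (sym hv₀)))
    ... | i , inj₁ (e , e′) with proj₂ alt i
    ...   | inj₂ (hd , _) = ⟶-asym (asuc⟶b 0) (subst₂ _⟶_ e′ e (⟶-· h (proj₁ hd)))
    ...   | inj₁ (_ , hd) = ¬Tail×Head (p-Tail 1)
          (subst Head (injective (·-injective h (trans e′ (sym hv₀)))) hd)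

    adjacent-hC : AdjacentCycles C hC
    adjacent-hC = C≉hC , w₀ , (next (p 0) , refl) , (p 1 , hv₀)

    A-free : ∀ i j → g ↑ i · v₀ ≡ g ↑ j · v₀ → i ≋ j [mod n ]
    A-free i j e = ≋-+-cancelˡ n 1 {i} {j} (a-inj {suc i} {suc j} (trans (sym (g↑v₀ i)) (trans e (g↑v₀ j))))

    B-free : ∀ i j → g ↑ i · w₀ ≡ g ↑ j · w₀ → i ≋ j [mod n ]
    B-free i j e = b-inj {i} {j} (trans (sym (g↑w₀ i)) (trans e (g↑w₀ j)))

    A-B-disjoint : ∀ i j → g ↑ i · v₀ ≢ g ↑ j · w₀
    A-B-disjoint i j e = a≢b {suc i} {j} (trans (sym (g↑v₀ i)) (trans e (g↑w₀ j)))

    A-period : g ↑ n · v₀ ≡ v₀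
    A-period = trans (g↑v₀ n) (cong vertex (p-≋ {suc n} {1} ([m+n]%n≡m%n 1 n)))

    v₀⟶gw₀ : v₀ ⟶ g · w₀
    v₀⟶gw₀ = subst (v₀ ⟶_) (sym (g↑w₀ 1)) (a⟶b 1)

    open AlternatingCycle n 4≤n g (asuc⟶b 0) v₀⟶gw₀ A-free B-free A-B-disjoint A-period
      using (InC; module Attached)

    InC⇔∈ : ∀ {z} → InC z ⇔ z ∈ⱽ C
    InC⇔∈ = mk⇔
      (λ { (inj₁ (j , refl)) → p (suc j) , sym (g↑v₀ j) ; (inj₂ (j , refl)) → next (p j) , sym (g↑w₀ j) })
      (λ { (i , refl) → Sum.map (λ { (j , e) → j , trans e (sym (g↑v₀ j)) })
                                (λ { (j , e) → j , trans e (sym (g↑w₀ j)) }) (cover i) })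

    common : Common C hC HasCardinality n → (λ z → InC z × ∃[ x ] InC x × h · x ≡ z) HasCardinality n
    common = HasCardinality-cong λ z → mk⇔
      (λ { (z∈ , x , x∈ , refl) → to InC⇔∈ z∈ , (let i , e = to InC⇔∈ x∈ in i , cong (h ·_) e) })
      (λ { (z∈ , i , e) → from InC⇔∈ z∈ , vertex i , from InC⇔∈ (i , refl) , e })
      where open Equivalence

    graph-iso : Common C hC HasCardinality n → 2 ∣ n → ∃[ q ] (X ≅ 𝒳ₑ q)
    graph-iso c 2∣n = parameters , isomorphism
      where
      open Attached h hv₀ (common c)
      open EvenRadius 2∣n

theorem2p2 : (X : Graph) → Connected X → HasValency X 4 →
    (G : Subgroup X) → HalfArcTransitive G →
    (o : Arc X) → TightlyAttached G o →
    (ρ : ℕ) → IsRadius G o ρ → 2 ∣ ρ → 4 ≤ ρ →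
    ∃[ p ] (X ≅ 𝒳ₑ p)
theorem2p2 X conn val G hat o (r , _ , (_ , len≡2r) , (_ , attachment) , refl) ρ ((C , alt) , len≡2ρ) 2∣ρ 4≤ρ
  with refl ← *-cancelˡ-≡ r ρ 2 (trans (sym (len≡2r C alt)) (len≡2ρ C alt))
  = graph-iso (attachment C hC alt hC-alternating adjacent-hC) 2∣ρ
  where
  instance
    ρ-nonZero : NonZero ρ
    ρ-nonZero = >-nonZero (≤-trans (s≤s z≤n) 4≤ρ)
  open TightlyAttachedGraph conn val G hat o
  open CycleToOrbits ρ 4≤ρ C alt (len≡2ρ C alt)
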